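{- Let $A_1,\ldots,A_n$ be finite sets of points in $\mathbb{R}^d$ and let $x\in\mathbb{R}^d$. If $x\in\mathrm{conv}(A_i)$ for all $i\in[n]$ and $n\ge d+2$, then $\mathbf{RG}_{\mathrm{CC}}((A_1,\ldots,A_n),x)$ is connected.
   Context: $\mathbf{RG}_{\mathrm{CC}}((A_1,\ldots,A_n),x)$ is the graph whose vertices are the ordered tuples $(a_1,\ldots,a_n)$ with $a_i\in A_i$ for all $i$ and $x\in\mathrm{conv}(\{a_1,\ldots,a_n\})$; two tuples $(a_1,\ldots,a_n)$ and $(b_1,\ldots,b_n)$ are adjacent if there is a unique index $j$ with $a_j\neq b_j$ and moreover $x\in\mathrm{conv}(\{a_i:i\neq j\})$. -}

module Defs where

open import Algebra.Bundles.Raw using (RawMonoid)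
import Algebra.Definitions.RawMonoid as RawMonoidSum
open import Data.Fin.Base using (Fin)
open import Data.List.Base using (List)
import Data.List.Membership.Setoid as ListMembership
open import Data.Nat.Base as ℕ using (ℕ; _⊔_)
import Data.Nat.Properties as ℕ
open import Data.Product.Base using (∃-syntax; _×_; _,_)
open import Data.Rational.Base as ℚ using (ℚ; 0ℚ; 1ℚ; ½; ∣_∣; positive)
import Data.Rational.Properties as ℚ
open import Data.Rational.Solver using (module +-*-Solver)
open import Data.Vec.Functional using (Vector)
import Data.Vec.Functional.Relation.Binary.Equality.Setoid as VectorEquality
open import Level using (0ℓ)
open import Relation.Binary.Bundles using (Setoid)
import Relation.Binary.Construct.On as On
open import Relation.Binary.Core using (Rel)
open import Relation.Binary.PropositionalEquality
  using (_≡_; _≢_; refl; sym; trans; cong; subst)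
open import Relation.Nullary.Negation.Core using (¬_)
open import Relation.Unary using (Pred; _∈_)

Eventually : Pred ℕ 0ℓ → Set
Eventually P = ∃[ N ] (∀ n → N ℕ.≤ n → P n)

IsCauchy : (ℕ → ℚ) → Set
IsCauchy s = ∀ ε → 0ℚ ℚ.< ε →
  ∃[ N ] (∀ m n → N ℕ.≤ m → N ℕ.≤ n → ∣ s m ℚ.- s n ∣ ℚ.< ε)

-- Equality of reals is _≈_ below (the difference is a null sequence), not _≡_.
record ℝ : Set where
  constructor mkℝ
  field
    seq      : ℕ → ℚ
    isCauchy : IsCauchy seq

open ℝ public

infix 4 _≈_ _≤_

record _≈_ (x y : ℝ) : Set where
  constructor mk≈
  field
    close : ∀ ε → 0ℚ ℚ.< ε → Eventually λ n → ∣ seq x n ℚ.- seq y n ∣ ℚ.< ε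

record _≤_ (x y : ℝ) : Set where
  constructor mk≤
  field
    below : ∀ ε → 0ℚ ℚ.< ε → Eventually λ n → seq x n ℚ.< seq y n ℚ.+ ε

private
  open ℚ.≤-Reasoning
  open +-*-Solver using (solve; _:=_; _:+_; _:*_; _:-_; :-_)

½ε>0 : ∀ ε → 0ℚ ℚ.< ε → 0ℚ ℚ.< ½ ℚ.* ε
½ε>0 ε ε>0 = ℚ.positive⁻¹ _ {{ℚ.pos*pos⇒pos ½ ε {{positive ε>0}}}}

halves : ∀ ε → ½ ℚ.* ε ℚ.+ ½ ℚ.* ε ≡ ε
halves ε = trans (sym (ℚ.*-distribʳ-+ ε ½ ½)) (ℚ.*-identityˡ ε)

∣p-p∣<ε : ∀ p {ε} → 0ℚ ℚ.< ε → ∣ p ℚ.- p ∣ ℚ.< ε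
∣p-p∣<ε p {ε} = subst (λ q → ∣ q ∣ ℚ.< ε) (sym (ℚ.+-inverseʳ p))

∣-∣-swap : ∀ p q → ∣ p ℚ.- q ∣ ≡ ∣ q ℚ.- p ∣
∣-∣-swap p q = trans (sym (ℚ.∣-p∣≡∣p∣ (p ℚ.- q)))
  (cong ∣_∣ (solve 2 (λ p q → :- (p :- q) := q :- p) refl p q))

∣+∣-split : ∀ {p q r} ε → r ≡ p ℚ.+ q →
            ∣ p ∣ ℚ.< ½ ℚ.* ε → ∣ q ∣ ℚ.< ½ ℚ.* ε → ∣ r ∣ ℚ.< ε
∣+∣-split {p} {q} {r} ε eq p< q< = begin-strict
  ∣ r ∣                  ≡⟨ cong ∣_∣ eq ⟩
  ∣ p ℚ.+ q ∣            ≤⟨ ℚ.∣p+q∣≤∣p∣+∣q∣ p q ⟩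
  ∣ p ∣ ℚ.+ ∣ q ∣        <⟨ ℚ.+-mono-< p< q< ⟩
  ½ ℚ.* ε ℚ.+ ½ ℚ.* ε    ≡⟨ halves ε ⟩
  ε                      ∎

abstract
  +-isCauchy : ∀ x y → IsCauchy (λ n → seq x n ℚ.+ seq y n)
  +-isCauchy x y ε ε>0
    with M , x-close ← isCauchy x (½ ℚ.* ε) (½ε>0 ε ε>0)
       | N , y-close ← isCauchy y (½ ℚ.* ε) (½ε>0 ε ε>0)
    = M ⊔ N , λ m n m≥ n≥ → ∣+∣-split ε
        (solve 4 (λ a b c d → (a :+ b) :- (c :+ d) := (a :- c) :+ (b :- d)) refl
          (seq x m) (seq y m) (seq x n) (seq y n))
        (x-close m n (ℕ.m⊔n≤o⇒m≤o M N m≥) (ℕ.m⊔n≤o⇒m≤o M N n≥))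
        (y-close m n (ℕ.m⊔n≤o⇒n≤o M N m≥) (ℕ.m⊔n≤o⇒n≤o M N n≥))

bounded : ∀ x → ∃[ B ] (0ℚ ℚ.< B × Eventually λ n → ∣ seq x n ∣ ℚ.≤ B)
bounded x with N , close ← isCauchy x 1ℚ (ℚ.positive⁻¹ 1ℚ) =
  1ℚ ℚ.+ ∣ seq x N ∣ ,
  ℚ.positive⁻¹ _ {{ℚ.pos+nonNeg⇒pos 1ℚ ∣ seq x N ∣ {{ℚ.∣-∣-nonNeg (seq x N)}}}} ,
  N , λ n n≥ → begin
    ∣ seq x n ∣
      ≡⟨ cong ∣_∣ (solve 2 (λ a b → a := (a :- b) :+ b) refl (seq x n) (seq x N)) ⟩
    ∣ (seq x n ℚ.- seq x N) ℚ.+ seq x N ∣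
      ≤⟨ ℚ.∣p+q∣≤∣p∣+∣q∣ (seq x n ℚ.- seq x N) (seq x N) ⟩
    ∣ seq x n ℚ.- seq x N ∣ ℚ.+ ∣ seq x N ∣
      ≤⟨ ℚ.+-monoˡ-≤ ∣ seq x N ∣ (ℚ.<⇒≤ (close n N n≥ ℕ.≤-refl)) ⟩
    1ℚ ℚ.+ ∣ seq x N ∣ ∎

tolerance : ∀ B ε → 0ℚ ℚ.< B → 0ℚ ℚ.< ε →
            ∃[ δ ] (0ℚ ℚ.< δ × B ℚ.* δ ≡ ½ ℚ.* ε)
tolerance B ε B>0 ε>0 = B⁻¹ ℚ.* (½ ℚ.* ε) ,
  ℚ.positive⁻¹ _ {{ℚ.pos*pos⇒pos B⁻¹ {{ℚ.1/pos⇒pos B}} (½ ℚ.* ε) {{positive (½ε>0 ε ε>0)}}}} ,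
  trans (sym (ℚ.*-assoc B B⁻¹ _))
    (trans (cong (ℚ._* (½ ℚ.* ε)) (ℚ.*-inverseʳ B)) (ℚ.*-identityˡ _))
  where
  instance
    B-pos = positive B>0
    B-nonZero = ℚ.pos⇒nonZero B
  B⁻¹ = ℚ.1/ B

∣*∣-bound : ∀ {p q B δ} → 0ℚ ℚ.< B → ∣ p ∣ ℚ.≤ B → ∣ q ∣ ℚ.< δ →
            ∣ p ℚ.* q ∣ ℚ.< B ℚ.* δ
∣*∣-bound {p} {q} {B} {δ} B>0 p≤ q< = begin-strict
  ∣ p ℚ.* q ∣        ≡⟨ ℚ.∣p*q∣≡∣p∣*∣q∣ p q ⟩
  ∣ p ∣ ℚ.* ∣ q ∣    ≤⟨ ℚ.*-monoʳ-≤-nonNeg ∣ q ∣ {{ℚ.∣-∣-nonNeg q}} p≤ ⟩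
  B ℚ.* ∣ q ∣        <⟨ ℚ.*-monoʳ-<-pos B {{positive B>0}} q< ⟩
  B ℚ.* δ            ∎

*-difference : ∀ a b c d →
               a ℚ.* b ℚ.- c ℚ.* d ≡ a ℚ.* (b ℚ.- d) ℚ.+ d ℚ.* (a ℚ.- c)
*-difference = solve 4
  (λ a b c d → (a :* b) :- (c :* d) := a :* (b :- d) :+ d :* (a :- c)) refl

∣*∣-difference : ∀ {a b c d B C δ η} ε → 0ℚ ℚ.< B → 0ℚ ℚ.< C →
                 B ℚ.* δ ≡ ½ ℚ.* ε → C ℚ.* η ≡ ½ ℚ.* ε →
                 ∣ a ∣ ℚ.≤ B → ∣ d ∣ ℚ.≤ C → ∣ b ℚ.- d ∣ ℚ.< δ → ∣ a ℚ.- c ∣ ℚ.< η →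
                 ∣ a ℚ.* b ℚ.- c ℚ.* d ∣ ℚ.< ε
∣*∣-difference {a} {b} {c} {d} ε B>0 C>0 Bδ≡ Cη≡ a≤ d≤ bd< ac< =
  ∣+∣-split ε (*-difference a b c d)
    (subst (∣ a ℚ.* (b ℚ.- d) ∣ ℚ.<_) Bδ≡ (∣*∣-bound {p = a} {q = b ℚ.- d} B>0 a≤ bd<))
    (subst (∣ d ℚ.* (a ℚ.- c) ∣ ℚ.<_) Cη≡ (∣*∣-bound {p = d} {q = a ℚ.- c} C>0 d≤ ac<))

abstract
  *-isCauchy : ∀ x y → IsCauchy (λ n → seq x n ℚ.* seq y n)
  *-isCauchy x y ε ε>0 =
    let B , B>0 , K , x≤B = bounded x
        C , C>0 , L , y≤C = bounded y
        δ , δ>0 , Bδ≡     = tolerance B ε B>0 ε>0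
        η , η>0 , Cη≡     = tolerance C ε C>0 ε>0
        M , x-close       = isCauchy x η η>0
        N , y-close       = isCauchy y δ δ>0
    in (K ⊔ L) ⊔ (M ⊔ N) , λ m n m≥ n≥ →
      let m≥K⊔L = ℕ.m⊔n≤o⇒m≤o (K ⊔ L) (M ⊔ N) m≥
          n≥K⊔L = ℕ.m⊔n≤o⇒m≤o (K ⊔ L) (M ⊔ N) n≥
          m≥M⊔N = ℕ.m⊔n≤o⇒n≤o (K ⊔ L) (M ⊔ N) m≥
          n≥M⊔N = ℕ.m⊔n≤o⇒n≤o (K ⊔ L) (M ⊔ N) n≥
      in ∣*∣-difference {seq x m} {seq y m} {seq x n} {seq y n} {B} {C} {δ} {η} ε
           B>0 C>0 Bδ≡ Cη≡
           (x≤B m (ℕ.m⊔n≤o⇒m≤o K L m≥K⊔L))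
           (y≤C n (ℕ.m⊔n≤o⇒n≤o K L n≥K⊔L))
           (y-close m n (ℕ.m⊔n≤o⇒n≤o M N m≥M⊔N) (ℕ.m⊔n≤o⇒n≤o M N n≥M⊔N))
           (x-close m n (ℕ.m⊔n≤o⇒m≤o M N m≥M⊔N) (ℕ.m⊔n≤o⇒m≤o M N n≥M⊔N))

fromℚ : ℚ → ℝ
fromℚ q = mkℝ (λ _ → q) (λ ε ε>0 → 0 , λ _ _ _ _ → ∣p-p∣<ε q ε>0)

0ℝ 1ℝ : ℝ
0ℝ = fromℚ 0ℚ
1ℝ = fromℚ 1ℚ

infixl 6 _+_
infixl 7 _*_

_+_ : ℝ → ℝ → ℝ
x + y = mkℝ (λ n → seq x n ℚ.+ seq y n) (+-isCauchy x y)

_*_ : ℝ → ℝ → ℝ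
x * y = mkℝ (λ n → seq x n ℚ.* seq y n) (*-isCauchy x y)

≈-refl : ∀ {x} → x ≈ x
≈-refl {x} = mk≈ λ ε ε>0 → 0 , λ n _ → ∣p-p∣<ε (seq x n) ε>0

≈-sym : ∀ {x y} → x ≈ y → y ≈ x
≈-sym {x} {y} (mk≈ x≈y) = mk≈ λ ε ε>0 →
  let N , xy-close = x≈y ε ε>0
  in N , λ n n≥ → subst (ℚ._< ε) (∣-∣-swap (seq x n) (seq y n)) (xy-close n n≥)

≈-trans : ∀ {x y z} → x ≈ y → y ≈ z → x ≈ z
≈-trans {x} {y} {z} (mk≈ x≈y) (mk≈ y≈z) = mk≈ λ ε ε>0 →
  let M , xy-close = x≈y (½ ℚ.* ε) (½ε>0 ε ε>0)
      N , yz-close = y≈z (½ ℚ.* ε) (½ε>0 ε ε>0)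
  in M ⊔ N , λ n n≥ → ∣+∣-split ε
      (solve 3 (λ a b c → a :- c := (a :- b) :+ (b :- c)) refl (seq x n) (seq y n) (seq z n))
      (xy-close n (ℕ.m⊔n≤o⇒m≤o M N n≥))
      (yz-close n (ℕ.m⊔n≤o⇒n≤o M N n≥))

ℝ-setoid : Setoid 0ℓ 0ℓ
ℝ-setoid = record
  { Carrier       = ℝ
  ; _≈_           = _≈_
  ; isEquivalence = record { refl = ≈-refl ; sym = ≈-sym ; trans = ≈-trans }
  }

+-0-rawMonoid : RawMonoid 0ℓ 0ℓ
+-0-rawMonoid = record { Carrier = ℝ ; _≈_ = _≈_ ; _∙_ = _+_ ; ε = 0ℝ }

open RawMonoidSum +-0-rawMonoid public using (sum)

Point : ℕ → Set
Point d = Vector ℝ d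

Point-setoid : ℕ → Setoid 0ℓ 0ℓ
Point-setoid = VectorEquality.≋-setoid ℝ-setoid

infix 4 _≋_

_≋_ : ∀ {d} → Rel (Point d) 0ℓ
_≋_ {d} = Setoid._≈_ (Point-setoid d)

record conv {d} (S : Pred (Point d) 0ℓ) (x : Point d) : Set where
  field
    size        : ℕ
    point       : Fin size → Point d
    weight      : Fin size → ℝ
    point∈S     : ∀ i → point i ∈ S
    weight≥0    : ∀ i → 0ℝ ≤ weight i
    weight-sum  : sum weight ≈ 1ℝ
    combination : x ≋ λ k → sum (λ i → weight i * point i k)

-- A finite set of points is given by a list; repetitions and the choice of
-- representatives modulo _≋_ do not affect the set it denotes.
⟦_⟧ : ∀ {d} → List (Point d) → Pred (Point d) 0ℓ
⟦_⟧ {d} A y = y ∈ˡ A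
  where open ListMembership (Point-setoid d) renaming (_∈_ to _∈ˡ_)

range : ∀ {d n} → (Fin n → Point d) → Pred (Point d) 0ℓ
range a y = ∃[ i ] y ≋ a i

rangeWithout : ∀ {d n} → Fin n → (Fin n → Point d) → Pred (Point d) 0ℓ
rangeWithout j a y = ∃[ i ] (i ≢ j × y ≋ a i)

record Graph : Set₁ where
  field
    vertices : Setoid 0ℓ 0ℓ
  open Setoid vertices public using () renaming (Carrier to Vertex; _≈_ to _≈ᵛ_)
  field
    Adjacent : Rel Vertex 0ℓ

module _ (G : Graph) where
  open Graph G

  data Walk : Rel Vertex 0ℓ where
    end  : ∀ {u v} → u ≈ᵛ v → Walk u v
    step : ∀ {u v w} → Adjacent u v → Walk v w → Walk u w

  -- As usual, a connected graph is required to be nonempty.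
  Connected : Set
  Connected = Vertex × (∀ u v → Walk u v)

module _ {d n : ℕ} (A : Fin n → List (Point d)) (x : Point d) where

  record ColourfulTuple : Set where
    field
      tuple  : Fin n → Point d
      chosen : ∀ i → tuple i ∈ ⟦ A i ⟧
      x∈conv : x ∈ conv (range tuple)

  open ColourfulTuple

  -- Symmetric, classically: a and b agree away from index.
  record Exchange (a b : ColourfulTuple) : Set where
    field
      index   : Fin n
      differs : ¬ tuple a index ≋ tuple b index
      unique  : ∀ i → ¬ tuple a i ≋ tuple b i → i ≡ index
      x∈conv  : x ∈ conv (rangeWithout index (tuple a))

  RG-CC : Graph
  RG-CC = record
    { vertices = On.setoid (VectorEquality.≋-setoid (Point-setoid d) n) tuple
    ; Adjacent = Exchange
    }

{-# OPTIONS --safe #-}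
module Submission where

-- Homogenise: with b = (1, x) and every point p replaced by (1, p), a tuple is a vertex iff b lies
-- in the cone of its n > d + 1 vectors, and an edge that exchanges the j-th entry must have b in
-- the cone of the other entries.  As in Bárány's proof of the colourful Carathéodory theorem, the
-- potential is the distance from b to a cone, here of a tuple with one entry omitted (the height
-- of an edge).  Any two tuples are joined by a path of single exchanges; take two vertices and a
-- path between them whose highest edge is as low as possible, and suppose its height is positive.
-- The consecutive tuples on this level all have the same residual r, the difference of b and its
-- projection y to the cone.  Every colour contains a point that r separates from the cone, and
-- exchanging an entry of weight zero for such a point lowers the height.  The combinations of the
-- tuple that give y form a polytope of dimension at least two, since r is orthogonal to all
-- vectors of positive weight, so its facets are connected through common points, that is, through
-- pairs of entries of weight zero.  Following them gives a lower path, which is a contradiction.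

open import Algebra.Bundles using (CommutativeRing)
import Algebra.Properties.AbelianGroup as AbelianGroupProperties
import Algebra.Properties.Ring as RingProperties
import Algebra.Properties.Semiring.Mult as SemiringMult
import Algebra.Properties.Semiring.Sum as SemiringSum
import Algebra.Solver.Ring as RingSolver
open import Algebra.Solver.Ring.AlmostCommutativeRing using (fromCommutativeRing; _-Raw-AlmostCommutative⟶_)
open import Axiom.ExcludedMiddle using (ExcludedMiddle)
open import Data.Fin.Base using (Fin; zero; suc; punchIn; toℕ; fromℕ<; funToFin; finToFun; combine; remQuot)
open import Data.Fin.Properties using (punchInᵢ≢i; toℕ-fromℕ<; toℕ-injective; toℕ<n; finToFun-funToFin; remQuot-combine)
  renaming (_≟_ to _≟ᶠ_)
open import Data.Integer.Base as ℤ using (ℤ; +_; -[1+_]; -1ℤ)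
import Data.Integer.Properties as ℤ
open import Data.List.Base using (List; concat; tabulate; length; lookup)
import Data.List.Membership.Setoid.Properties as Membership
import Data.List.Relation.Unary.Any as Any
open import Data.List.Relation.Unary.Any.Properties using (concat⁺; tabulate⁺; lookup-index)
open import Data.Maybe.Base using (just; nothing)
open import Data.Nat.Base as ℕ using (ℕ; zero; suc; s≤s; z≤n; _⊔_; _≥_)
import Data.Nat.Properties as ℕ
open import Data.Product.Base using (∃-syntax; _×_; _,_; proj₁; proj₂)
open import Data.Rational.Base as ℚ using (ℚ; 0ℚ; 1ℚ; ½; ∣_∣)
import Data.Rational.Properties as ℚ
open import Data.Rational.Solver using (module +-*-Solver)
open import Data.Sum.Base using (_⊎_; inj₁; inj₂)
open import Data.Unit.Base using (⊤; tt)
open import Data.Vec.Functional using (Vector; _∷_; insertAt; updateAt)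
open import Data.Vec.Functional.Properties using (insertAt-lookup; insertAt-punchIn; updateAt-updates; updateAt-minimal)
open import Function.Base using (const; _∘_; case_of_)
open import Level using (0ℓ)
open import Relation.Binary.Bundles using (Setoid)
open import Relation.Binary.Construct.Closure.ReflexiveTransitive as Star using (Star; _◅_; _◅◅_) renaming (ε to [])
open import Relation.Binary.Core using (Rel)
open import Relation.Binary.Definitions using (WeaklyDecidable)
import Relation.Binary.Reasoning.Setoid as SetoidReasoning
open import Relation.Binary.PropositionalEquality as ≡ using (_≡_; _≢_; _≗_)
open import Relation.Binary.Structures using (IsTotalOrder)
open import Relation.Nullary using (¬_; Dec; yes; no; contradiction)
open import Relation.Unary using (Pred; _∈_)

-- The bound n > d + 1 enters as follows. A nonzero residual r confines the vectors of positive
-- weight to the hyperplane orthogonal to r, of dimension d. If all entries but one lie there, they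
-- are at least d + 1 vectors, so a nonzero dependence can be required to vanish at one prescribed
-- entry. This keeps a chosen facet fixed while the weights move. The functional `e₀`, which is 1 on
-- every homogenised point, forces each such motion out of the nonnegative orthant, so a second
-- weight reaches zero. A lower edge needs both zeros: one entry is omitted, the other exchanged.
-- The facets are connected by a walk in one planar section of the polytope.
--
-- Distances are squared and projections are found by recursion on the generators, so the geometry
-- takes place in an arbitrary ordered field. Extremal choices are minima over finite index sets,
-- with excluded middle deciding the comparisons; the descent is thus a single contradiction with
-- minimality.

-- Ring normalisation with integer coefficients

module IntegerCoefficients (R : CommutativeRing 0ℓ 0ℓ) where
  open CommutativeRing R
  open RingProperties ring
  open AbelianGroupProperties +-abelianGroup using (⁻¹-∙-comm)
  open SemiringMult semiring using (×-homo-+; ×1-homo-*) renaming (_×_ to _·_)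
  open SetoidReasoning setoid

  -- By computation `+ 1` goes to `1# + 0#` and not to `1#`. Hence the terms `- (1# + 0#)` in later
  -- calculations: they are the solver's constant `-1ℤ`.
  ⟦_⟧ᶻ : ℤ → Carrier
  ⟦ + n ⟧ᶻ      = n · 1#
  ⟦ -[1+ n ] ⟧ᶻ = - (suc n · 1#)

  neg-homo : ∀ i → ⟦ ℤ.- i ⟧ᶻ ≈ - ⟦ i ⟧ᶻ
  neg-homo (+ zero)  = sym -0#≈0#
  neg-homo (+ suc n) = refl
  neg-homo -[1+ n ]  = sym (-‿involutive _)

  ⊖-homo : ∀ m n → ⟦ m ℤ.⊖ n ⟧ᶻ ≈ m · 1# - n · 1#
  ⊖-homo m       zero    = sym (trans (+-congˡ -0#≈0#) (+-identityʳ _))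
  ⊖-homo zero    (suc n) = sym (+-identityˡ _)
  ⊖-homo (suc m) (suc n) = begin
    ⟦ suc m ℤ.⊖ suc n ⟧ᶻ                    ≡⟨ ≡.cong ⟦_⟧ᶻ (ℤ.[1+m]⊖[1+n]≡m⊖n m n) ⟩
    ⟦ m ℤ.⊖ n ⟧ᶻ                            ≈⟨ ⊖-homo m n ⟩
    m · 1# - n · 1#                         ≈⟨ +-congʳ (trans (+-congʳ (-‿inverseʳ 1#)) (+-identityˡ _)) ⟨
    (1# - 1#) + m · 1# - n · 1#             ≈⟨ +-congʳ (trans (+-assoc 1# (- 1#) _) (+-congˡ (+-comm _ _))) ⟩
    1# + (m · 1# - 1#) - n · 1#             ≈⟨ +-congʳ (+-assoc 1# _ _) ⟨
    (1# + m · 1# - 1#) - n · 1#             ≈⟨ +-assoc _ _ _ ⟩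
    1# + m · 1# + (- 1# - n · 1#)           ≈⟨ +-congˡ (⁻¹-∙-comm 1# _) ⟩
    1# + m · 1# - (1# + n · 1#)             ∎

  +-homo : ∀ i j → ⟦ i ℤ.+ j ⟧ᶻ ≈ ⟦ i ⟧ᶻ + ⟦ j ⟧ᶻ
  +-homo (+ m)    (+ n)    = ×-homo-+ 1# m n
  +-homo (+ m)    -[1+ n ] = ⊖-homo m (suc n)
  +-homo -[1+ m ] (+ n)    = trans (⊖-homo n (suc m)) (+-comm _ _)
  +-homo -[1+ m ] -[1+ n ] = begin
    - (suc (suc (m ℕ.+ n)) · 1#)    ≡⟨ ≡.cong (λ k → - (k · 1#)) (≡.cong suc (ℕ.+-suc m n)) ⟨
    - ((suc m ℕ.+ suc n) · 1#)      ≈⟨ -‿cong (×-homo-+ 1# (suc m) (suc n)) ⟩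
    - (suc m · 1# + suc n · 1#)     ≈⟨ ⁻¹-∙-comm _ _ ⟨
    - (suc m · 1#) - (suc n · 1#)   ∎

  +*-homo : ∀ m j → ⟦ + m ℤ.* j ⟧ᶻ ≈ m · 1# * ⟦ j ⟧ᶻ
  +*-homo m (+ n) = begin
    ⟦ + m ℤ.* + n ⟧ᶻ      ≡⟨ ≡.cong ⟦_⟧ᶻ (ℤ.pos-* m n) ⟨
    (m ℕ.* n) · 1#        ≈⟨ ×1-homo-* m n ⟩
    m · 1# * (n · 1#)     ∎
  +*-homo m -[1+ n ] = begin
    ⟦ + m ℤ.* -[1+ n ] ⟧ᶻ         ≡⟨ ≡.cong ⟦_⟧ᶻ (ℤ.neg-distribʳ-* (+ m) (+ suc n)) ⟨
    ⟦ ℤ.- (+ m ℤ.* + suc n) ⟧ᶻ    ≈⟨ neg-homo (+ m ℤ.* + suc n) ⟩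
    - ⟦ + m ℤ.* + suc n ⟧ᶻ        ≈⟨ -‿cong (+*-homo m (+ suc n)) ⟩
    - (m · 1# * (suc n · 1#))     ≈⟨ -‿distribʳ-* _ _ ⟩
    m · 1# * - (suc n · 1#)       ∎

  *-homo : ∀ i j → ⟦ i ℤ.* j ⟧ᶻ ≈ ⟦ i ⟧ᶻ * ⟦ j ⟧ᶻ
  *-homo (+ m)    j = +*-homo m j
  *-homo -[1+ m ] j = begin
    ⟦ -[1+ m ] ℤ.* j ⟧ᶻ           ≡⟨ ≡.cong ⟦_⟧ᶻ (ℤ.neg-distribˡ-* (+ suc m) j) ⟨
    ⟦ ℤ.- (+ suc m ℤ.* j) ⟧ᶻ      ≈⟨ neg-homo (+ suc m ℤ.* j) ⟩
    - ⟦ + suc m ℤ.* j ⟧ᶻ          ≈⟨ -‿cong (+*-homo (suc m) j) ⟩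
    - (suc m · 1# * ⟦ j ⟧ᶻ)       ≈⟨ -‿distribˡ-* _ _ ⟩
    - (suc m · 1#) * ⟦ j ⟧ᶻ       ∎

  morphism : ℤ.+-*-rawRing -Raw-AlmostCommutative⟶ fromCommutativeRing R
  morphism = record
    { ⟦_⟧    = ⟦_⟧ᶻ
    ; +-homo = +-homo
    ; *-homo = *-homo
    ; -‿homo = neg-homo
    ; 0-homo = refl
    ; 1-homo = +-identityʳ 1#
    }

  coefficient-≟ : WeaklyDecidable (λ i j → ⟦ i ⟧ᶻ ≈ ⟦ j ⟧ᶻ)
  coefficient-≟ i j with i ℤ.≟ j
  ... | yes ≡.refl = just refl
  ... | no  _      = nothing

  open RingSolver ℤ.+-*-rawRing (fromCommutativeRing R) morphism coefficient-≟ public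
    using (solve; con; _:=_; _:+_; _:*_; _:-_; :-_)

-- Ordered fields

record OrderedField : Set₁ where
  infix 4 _≤_
  field
    commutativeRing : CommutativeRing 0ℓ 0ℓ
  open CommutativeRing commutativeRing public hiding (zero)
  field
    _≤_          : Rel Carrier 0ℓ
    isTotalOrder : IsTotalOrder _≈_ _≤_
    +-monoʳ-≤    : ∀ x {y z} → y ≤ z → x + y ≤ x + z
    *-nonNeg     : ∀ {x y} → 0# ≤ x → 0# ≤ y → 0# ≤ x * y
    inverse      : ∀ x → ¬ x ≈ 0# → ∃[ y ] x * y ≈ 1#
    1≰0          : ¬ 1# ≤ 0#

module FieldOrder (em : ExcludedMiddle 0ℓ) (F : OrderedField) where
  open OrderedField F
  open IntegerCoefficients commutativeRing
  open IsTotalOrder isTotalOrder public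
    using (antisym; total) renaming (reflexive to ≤-reflexive; trans to ≤-trans; refl to ≤-refl)

  infix 4 _<_

  _<_ : Rel Carrier 0ℓ
  x < y = ¬ y ≤ x

  ≰⇒≥ : ∀ {x y} → ¬ x ≤ y → y ≤ x
  ≰⇒≥ {x} {y} x≰y with total x y
  ... | inj₁ x≤y = contradiction x≤y x≰y
  ... | inj₂ y≤x = y≤x

  <⇒≤ : ∀ {x y} → x < y → x ≤ y
  <⇒≤ = ≰⇒≥

  ≮⇒≥ : ∀ {x y} → ¬ x < y → y ≤ x
  ≮⇒≥ {x} {y} x≮y with em {y ≤ x}
  ... | yes y≤x = y≤x
  ... | no  y≰x = contradiction y≰x x≮y

  ≤-<-trans : ∀ {x y z} → x ≤ y → y < z → x < z
  ≤-<-trans x≤y y<z z≤x = y<z (≤-trans z≤x x≤y)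

  <-≤-trans : ∀ {x y z} → x < y → y ≤ z → x < z
  <-≤-trans x<y y≤z z≤x = x<y (≤-trans y≤z z≤x)

  ≤-respˡ : ∀ {x y z} → x ≈ y → x ≤ z → y ≤ z
  ≤-respˡ x≈y = ≤-trans (≤-reflexive (sym x≈y))

  ≤-respʳ : ∀ {x y z} → x ≈ y → z ≤ x → z ≤ y
  ≤-respʳ x≈y z≤x = ≤-trans z≤x (≤-reflexive x≈y)

  +-monoˡ-≤ : ∀ x {y z} → y ≤ z → y + x ≤ z + x
  +-monoˡ-≤ x y≤z = ≤-respˡ (+-comm _ _) (≤-respʳ (+-comm _ _) (+-monoʳ-≤ x y≤z))

  +-mono-≤ : ∀ {x y u v} → x ≤ y → u ≤ v → x + u ≤ y + v
  +-mono-≤ {x} {y} {u} {v} x≤y u≤v = ≤-trans (+-monoˡ-≤ u x≤y) (+-monoʳ-≤ y u≤v)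

  +-nonNeg : ∀ {x y} → 0# ≤ x → 0# ≤ y → 0# ≤ x + y
  +-nonNeg x≥0 y≥0 = ≤-respˡ (+-identityˡ 0#) (+-mono-≤ x≥0 y≥0)

  +-nonPos : ∀ {x y} → x ≤ 0# → y ≤ 0# → x + y ≤ 0#
  +-nonPos x≤0 y≤0 = ≤-respʳ (+-identityˡ 0#) (+-mono-≤ x≤0 y≤0)

  x≤y⇒0≤y-x : ∀ {x y} → x ≤ y → 0# ≤ y - x
  x≤y⇒0≤y-x {x} x≤y = ≤-respˡ (-‿inverseʳ x) (+-monoˡ-≤ (- x) x≤y)

  0≤y-x⇒x≤y : ∀ {x y} → 0# ≤ y - x → x ≤ y
  0≤y-x⇒x≤y {x} {y} 0≤ = ≤-respˡ (+-identityˡ x)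
    (≤-respʳ (solve 2 (λ x y → (y :- x) :+ x := y) refl x y) (+-monoˡ-≤ x 0≤))

  neg-nonNeg : ∀ {x} → x ≤ 0# → 0# ≤ - x
  neg-nonNeg {x} x≤0 = ≤-respʳ (+-identityˡ (- x)) (x≤y⇒0≤y-x x≤0)

  neg-nonPos : ∀ {x} → 0# ≤ x → - x ≤ 0#
  neg-nonPos {x} x≥0 = 0≤y-x⇒x≤y (≤-respʳ (solve 1 (λ x → x := con (+ 0) :- (:- x)) refl x) x≥0)

  *-nonNeg-nonPos : ∀ {x y} → 0# ≤ x → y ≤ 0# → x * y ≤ 0#
  *-nonNeg-nonPos {x} {y} x≥0 y≤0 = ≤-respˡ (solve 2 (λ x y → :- (x :* (:- y)) := x :* y) refl x y)
    (neg-nonPos (*-nonNeg x≥0 (neg-nonNeg y≤0)))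

  sq-nonNeg : ∀ x → 0# ≤ x * x
  sq-nonNeg x with total 0# x
  ... | inj₁ x≥0 = *-nonNeg x≥0 x≥0
  ... | inj₂ x≤0 = ≤-respʳ (solve 1 (λ x → (:- x) :* (:- x) := x :* x) refl x)
                     (*-nonNeg (neg-nonNeg x≤0) (neg-nonNeg x≤0))

  zero-product : ∀ {x y} → x * y ≈ 0# → ¬ x ≈ 0# → y ≈ 0#
  zero-product {x} {y} xy≈0 x≉0 with x⁻¹ , xx⁻¹≈1 ← inverse x x≉0 = begin
    y               ≈⟨ *-identityˡ y ⟨
    1# * y          ≈⟨ *-congʳ xx⁻¹≈1 ⟨
    x * x⁻¹ * y     ≈⟨ solve 3 (λ x z y → x :* z :* y := z :* (x :* y)) refl x x⁻¹ y ⟩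
    x⁻¹ * (x * y)   ≈⟨ *-congˡ xy≈0 ⟩
    x⁻¹ * 0#        ≈⟨ zeroʳ x⁻¹ ⟩
    0#              ∎
    where open SetoidReasoning setoid

  sq-zero : ∀ {x} → x * x ≈ 0# → x ≈ 0#
  sq-zero {x} xx≈0 with em {x ≈ 0#}
  ... | yes x≈0 = x≈0
  ... | no  x≉0 = zero-product xx≈0 x≉0

  pos⇒≉0 : ∀ {x} → 0# < x → ¬ x ≈ 0#
  pos⇒≉0 x>0 x≈0 = x>0 (≤-reflexive x≈0)

  neg⇒≉0 : ∀ {x} → x < 0# → ¬ x ≈ 0#
  neg⇒≉0 x<0 x≈0 = x<0 (≤-reflexive (sym x≈0))

  nonNeg∧≉0⇒pos : ∀ {x} → 0# ≤ x → ¬ x ≈ 0# → 0# < x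
  nonNeg∧≉0⇒pos x≥0 x≉0 x≤0 = x≉0 (antisym x≤0 x≥0)

  *-pos-neg : ∀ {x y} → 0# < x → y < 0# → x * y < 0#
  *-pos-neg x>0 y<0 0≤xy =
    neg⇒≉0 y<0 (zero-product (antisym (*-nonNeg-nonPos (<⇒≤ x>0) (<⇒≤ y<0)) 0≤xy) (pos⇒≉0 x>0))

  +-neg-nonPos : ∀ {x y} → x < 0# → y ≤ 0# → x + y < 0#
  +-neg-nonPos {x} {y} x<0 y≤0 0≤x+y =
    x<0 (≤-trans 0≤x+y (≤-respʳ (+-identityʳ x) (+-monoʳ-≤ x y≤0)))

-- Linear algebra: projections to cones, linear dependence, the ratio test

module LinearAlgebra (em : ExcludedMiddle 0ℓ) (F : OrderedField) where
  open OrderedField F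
  open FieldOrder em F
  open IntegerCoefficients commutativeRing
  open SemiringSum semiring
    using (sum; sum-cong-≋; ∑-distrib-+; ∑-comm; sum-remove; sum-replicate-zero; *-distribˡ-sum; *-distribʳ-sum)
  open SetoidReasoning setoid

  Vect : ℕ → Set
  Vect = Vector Carrier

  private variable
    n D : ℕ

  dot : Vect D → Vect D → Carrier
  dot x y = sum (λ k → x k * y k)

  normSq : Vect D → Carrier
  normSq x = dot x x

  comb : Vect n → (Fin n → Vect D) → Vect D
  comb w v k = sum (λ i → w i * v i k)

  sum-0 : ∀ {f : Vect n} → (∀ i → f i ≈ 0#) → sum f ≈ 0#
  sum-0 {n} f≈0 = trans (sum-cong-≋ f≈0) (sum-replicate-zero n)

  sum-nonNeg : ∀ {f : Vect n} → (∀ i → 0# ≤ f i) → 0# ≤ sum f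
  sum-nonNeg {zero}  f≥0 = ≤-refl
  sum-nonNeg {suc n} f≥0 = +-nonNeg (f≥0 zero) (sum-nonNeg (λ i → f≥0 (suc i)))

  sum-nonPos : ∀ {f : Vect n} → (∀ i → f i ≤ 0#) → sum f ≤ 0#
  sum-nonPos {zero}  f≤0 = ≤-refl
  sum-nonPos {suc n} f≤0 = +-nonPos (f≤0 zero) (sum-nonPos (λ i → f≤0 (suc i)))

  nonNeg-sum-zero : ∀ {f : Vect n} → (∀ i → 0# ≤ f i) → sum f ≤ 0# → ∀ i → f i ≈ 0#
  nonNeg-sum-zero {suc n} {f} f≥0 ∑≤0 zero = antisym
    (≤-trans (≤-respˡ (+-identityʳ _) (+-monoʳ-≤ (f zero) (sum-nonNeg (λ i → f≥0 (suc i))))) ∑≤0)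
    (f≥0 zero)
  nonNeg-sum-zero {suc n} {f} f≥0 ∑≤0 (suc i) = nonNeg-sum-zero (λ j → f≥0 (suc j))
    (≤-trans (≤-respˡ (+-identityˡ _) (+-monoˡ-≤ (sum (λ j → f (suc j))) (f≥0 zero))) ∑≤0) i

  nonPos-sum-zero : ∀ {f : Vect n} → (∀ i → f i ≤ 0#) → 0# ≤ sum f → ∀ i → f i ≈ 0#
  nonPos-sum-zero {suc n} {f} f≤0 0≤∑ zero = antisym (f≤0 zero)
    (≤-trans 0≤∑ (≤-respʳ (+-identityʳ _) (+-monoʳ-≤ (f zero) (sum-nonPos (λ i → f≤0 (suc i))))))
  nonPos-sum-zero {suc n} {f} f≤0 0≤∑ (suc i) = nonPos-sum-zero (λ j → f≤0 (suc j))
    (≤-trans 0≤∑ (≤-respʳ (+-identityˡ _) (+-monoˡ-≤ (sum (λ j → f (suc j))) (f≤0 zero)))) i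

  sum-single : ∀ {f : Vect n} j → (∀ i → i ≢ j → f i ≈ 0#) → sum f ≈ f j
  sum-single {suc n} {f} j f≈0 = begin
    sum f                                ≈⟨ sum-remove {i = j} f ⟩
    f j + sum (λ i → f (punchIn j i))    ≈⟨ +-congˡ (sum-0 (λ i → f≈0 (punchIn j i) (punchInᵢ≢i j i))) ⟩
    f j + 0#                             ≈⟨ +-identityʳ (f j) ⟩
    f j                                  ∎

  sum-linear : ∀ c (f g : Vect n) → sum (λ i → f i + c * g i) ≈ sum f + c * sum g
  sum-linear c f g = trans (∑-distrib-+ f (λ i → c * g i)) (+-congˡ (sym (*-distribˡ-sum c g)))

  dot-cong : ∀ {x x′ y y′ : Vect D} → (∀ k → x k ≈ x′ k) → (∀ k → y k ≈ y′ k) → dot x y ≈ dot x′ y′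
  dot-cong x≈ y≈ = sum-cong-≋ (λ k → *-cong (x≈ k) (y≈ k))

  dot-congˡ : ∀ (x : Vect D) {y y′ : Vect D} → (∀ k → y k ≈ y′ k) → dot x y ≈ dot x y′
  dot-congˡ x = dot-cong {x = x} (λ _ → refl)

  dot-comm : ∀ (x y : Vect D) → dot x y ≈ dot y x
  dot-comm x y = sum-cong-≋ (λ k → *-comm (x k) (y k))

  dot-linear : ∀ (r x : Vect D) c (y : Vect D) → dot r (λ k → x k + c * y k) ≈ dot r x + c * dot r y
  dot-linear r x c y = trans
    (sum-cong-≋ λ k → solve 4 (λ r x c y → r :* (x :+ c :* y) := r :* x :+ c :* (r :* y)) refl (r k) (x k) c (y k))
    (sum-linear c (λ k → r k * x k) (λ k → r k * y k))

  dot-sub : ∀ (r x y : Vect D) → dot r (λ k → x k - y k) ≈ dot r x - dot r y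
  dot-sub r x y = begin
    dot r (λ k → x k - y k)
      ≈⟨ dot-congˡ r (λ k → solve 2 (λ x y → x :- y := x :+ con -1ℤ :* y) refl (x k) (y k)) ⟩
    dot r (λ k → x k + (- (1# + 0#)) * y k)
      ≈⟨ dot-linear r x (- (1# + 0#)) y ⟩
    dot r x + (- (1# + 0#)) * dot r y
      ≈⟨ solve 2 (λ x y → x :+ con -1ℤ :* y := x :- y) refl (dot r x) (dot r y) ⟩
    dot r x - dot r y ∎

  dot-+ : ∀ (r x y : Vect D) → dot r (λ k → x k + y k) ≈ dot r x + dot r y
  dot-+ r x y = trans (sum-cong-≋ (λ k → distribˡ (r k) (x k) (y k)))
    (∑-distrib-+ (λ k → r k * x k) (λ k → r k * y k))

  dot-comb : ∀ (r : Vect D) (w : Vect n) v → dot r (comb w v) ≈ sum (λ i → w i * dot r (v i))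
  dot-comb {D} {n} r w v = begin
    sum (λ k → r k * sum (λ i → w i * v i k))
      ≈⟨ sum-cong-≋ (λ k → *-distribˡ-sum (r k) (λ i → w i * v i k)) ⟩
    sum (λ k → sum (λ i → r k * (w i * v i k)))
      ≈⟨ ∑-comm (λ k i → r k * (w i * v i k)) ⟩
    sum (λ i → sum (λ k → r k * (w i * v i k)))
      ≈⟨ sum-cong-≋ (λ i → sum-cong-≋ λ k →
           solve 3 (λ r w v → r :* (w :* v) := w :* (r :* v)) refl (r k) (w i) (v i k)) ⟩
    sum (λ i → sum (λ k → w i * (r k * v i k)))
      ≈⟨ sum-cong-≋ (λ i → *-distribˡ-sum (w i) (λ k → r k * v i k)) ⟨
    sum (λ i → w i * dot r (v i)) ∎

  dot-comb-nonPos : ∀ (r : Vect D) (w : Vect n) v → (∀ i → 0# ≤ w i) → (∀ i → dot r (v i) ≤ 0#) →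
                    dot r (comb w v) ≤ 0#
  dot-comb-nonPos r w v w≥0 rv≤0 =
    ≤-respˡ (sym (dot-comb r w v)) (sum-nonPos (λ i → *-nonNeg-nonPos (w≥0 i) (rv≤0 i)))

  comb-linear : ∀ (w : Vect n) c (u : Vect n) (v : Fin n → Vect D) k →
                comb (λ i → w i + c * u i) v k ≈ comb w v k + c * comb u v k
  comb-linear w c u v k = trans
    (sum-cong-≋ λ i → solve 4 (λ w c u x → (w :+ c :* u) :* x := w :* x :+ c :* (u :* x)) refl (w i) c (u i) (v i k))
    (sum-linear c (λ i → w i * v i k) (λ i → u i * v i k))

  normSq-nonNeg : ∀ (x : Vect D) → 0# ≤ normSq x
  normSq-nonNeg x = sum-nonNeg (λ k → sq-nonNeg (x k))

  normSq-zero : ∀ {x : Vect D} → normSq x ≤ 0# → ∀ k → x k ≈ 0#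
  normSq-zero {x = x} x²≤0 k = sq-zero (nonNeg-sum-zero (λ k → sq-nonNeg (x k)) x²≤0 k)

  dot-zeroʳ : ∀ (x : Vect D) {y : Vect D} → (∀ k → y k ≈ 0#) → dot x y ≈ 0#
  dot-zeroʳ x y≈0 = sum-0 (λ k → trans (*-congˡ (y≈0 k)) (zeroʳ (x k)))

  normSq-split : ∀ (x y : Vect D) → let δ = λ k → x k - y k in
                 normSq x ≈ (normSq y + normSq δ) + (dot y δ + dot y δ)
  normSq-split x y = begin
    sum (λ k → x k * x k)
      ≈⟨ sum-cong-≋ (λ k → solve 2 (λ x y → x :* x :=
           (y :* y :+ (x :- y) :* (x :- y)) :+ (y :* (x :- y) :+ y :* (x :- y))) refl (x k) (y k)) ⟩
    sum (λ k → (y k * y k + δ k * δ k) + (y k * δ k + y k * δ k))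
      ≈⟨ ∑-distrib-+ (λ k → y k * y k + δ k * δ k) (λ k → y k * δ k + y k * δ k) ⟩
    sum (λ k → y k * y k + δ k * δ k) + sum (λ k → y k * δ k + y k * δ k)
      ≈⟨ +-cong (∑-distrib-+ (λ k → y k * y k) (λ k → δ k * δ k)) (∑-distrib-+ (λ k → y k * δ k) (λ k → y k * δ k)) ⟩
    (normSq y + normSq δ) + (dot y δ + dot y δ) ∎
    where δ = λ k → x k - y k

  pythagoras-≤ : ∀ (y r y′ r′ : Vect D) → (∀ k → y k + r k ≈ y′ k + r′ k) →
                 dot r′ y′ ≈ 0# → dot r′ y ≤ 0# →
                 normSq r′ + normSq (λ k → r k - r′ k) ≤ normSq r
  pythagoras-≤ y r y′ r′ eq orth polar =
    ≤-respʳ (sym (normSq-split r r′))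
      (≤-respˡ (+-identityʳ _) (+-monoʳ-≤ _ (+-nonNeg r′δ≥0 r′δ≥0)))
    where
    r′δ≥0 : 0# ≤ dot r′ (λ k → r k - r′ k)
    r′δ≥0 = ≤-respʳ
      (begin
        - dot r′ y                  ≈⟨ +-identityˡ _ ⟨
        0# - dot r′ y               ≈⟨ +-congʳ orth ⟨
        dot r′ y′ - dot r′ y        ≈⟨ dot-sub r′ y′ y ⟨
        dot r′ (λ k → y′ k - y k)   ≈⟨ dot-congˡ r′ (λ k → begin
            y′ k - y k
              ≈⟨ solve 3 (λ a b c → a :- b := (a :+ c) :- (b :+ c)) refl (y′ k) (y k) (r′ k) ⟩
            (y′ k + r′ k) - (y k + r′ k)
              ≈⟨ +-congʳ (eq k) ⟨
            (y k + r k) - (y k + r′ k)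
              ≈⟨ solve 3 (λ y r s → (y :+ r) :- (y :+ s) := r :- s) refl (y k) (r k) (r′ k) ⟩
            r k - r′ k ∎) ⟩
        dot r′ (λ k → r k - r′ k)   ∎)
      (neg-nonNeg polar)

  closest-unique : ∀ (y r y′ r′ : Vect D) → (∀ k → y k + r k ≈ y′ k + r′ k) →
                   dot r′ y′ ≈ 0# → dot r′ y ≤ 0# → normSq r ≤ normSq r′ → ∀ k → r k ≈ r′ k
  closest-unique y r y′ r′ eq orth polar r²≤r′² k = begin
    r k                   ≈⟨ solve 2 (λ a b → a := (a :- b) :+ b) refl (r k) (r′ k) ⟩
    (r k - r′ k) + r′ k   ≈⟨ +-congʳ (normSq-zero δ²≤0 k) ⟩
    0# + r′ k             ≈⟨ +-identityˡ (r′ k) ⟩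
    r′ k                  ∎
    where
    δ = λ k → r k - r′ k
    δ²≤0 : normSq δ ≤ 0#
    δ²≤0 = ≤-respˡ (solve 2 (λ a b → (a :+ b) :+ (:- a) := b) refl (normSq r′) (normSq δ))
      (≤-respʳ (-‿inverseʳ _)
        (+-monoˡ-≤ (- normSq r′) (≤-trans (pythagoras-≤ y r y′ r′ eq orth polar) r²≤r′²)))

  -- b - residual is the point of the cone spanned by v that is closest to b.
  record Projection (v : Fin n → Vect D) (b : Vect D) : Set where
    field
      weight     : Vect n
      residual   : Vect D
      weight≥0   : ∀ i → 0# ≤ weight i
      splits     : ∀ k → b k ≈ comb weight v k + residual k
      polar      : ∀ i → dot residual (v i) ≤ 0#
      orthogonal : dot residual (comb weight v) ≈ 0#

  -- Induction on the generators gives the nearest point by algebra alone. If the residual for the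
  -- remaining vectors is not polar to `v zero`, the wanted residual is orthogonal to `v zero`, so
  -- this line is factored out: project inside its orthogonal complement and recover the coefficient
  -- of `v zero` afterwards. The delicate point is the sign of that coefficient.
  project : ∀ (v : Fin n → Vect D) b → Projection v b
  project {zero} v b = record
    { weight     = λ ()
    ; residual   = b
    ; weight≥0   = λ ()
    ; splits     = λ k → sym (+-identityˡ (b k))
    ; polar      = λ ()
    ; orthogonal = sum-0 (λ k → zeroʳ (b k))
    }
  project {suc n} {D} v b with project (λ i → v (suc i)) b
  ... | Q with em {dot (Projection.residual Q) (v zero) ≤ 0#}
  ...   | yes rv₀≤0 = record
    { weight     = 0# ∷ weight
    ; residual   = residual
    ; weight≥0   = λ { zero → ≤-refl ; (suc i) → weight≥0 i }
    ; splits     = λ k → trans (splits k) (+-congʳ (extend k))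
    ; polar      = λ { zero → rv₀≤0 ; (suc i) → polar i }
    ; orthogonal = trans (dot-congˡ residual (λ k → sym (extend k))) orthogonal
    }
    where
    open Projection Q
    extend : ∀ k → comb weight (λ i → v (suc i)) k ≈ comb (0# ∷ weight) v k
    extend k = sym (trans (+-congʳ (zeroˡ _)) (+-identityˡ _))
  ...   | no  rv₀>0 = record
    { weight     = t ∷ P.weight
    ; residual   = s
    ; weight≥0   = λ { zero → t≥0 ; (suc i) → P.weight≥0 i }
    ; splits     = b-splits
    ; polar      = λ { zero → ≤-reflexive s⊥v₀ ; (suc i) → ≤-respˡ (dot-flatten s (v (suc i)) s⊥v₀) (P.polar i) }
    ; orthogonal = s⊥y
    }
    where
    module Q = Projection Q
    v₀ = v zero

    v₀²≉0 : ¬ normSq v₀ ≈ 0#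
    v₀²≉0 v₀²≈0 = rv₀>0 (≤-reflexive (dot-zeroʳ Q.residual (normSq-zero (≤-reflexive v₀²≈0))))

    c  = proj₁ (inverse (normSq v₀) v₀²≉0)
    v₀²c≈1 = proj₂ (inverse (normSq v₀) v₀²≉0)

    α : Vect D → Carrier
    α x = dot v₀ x * c

    flatten : Vect D → Vect D
    flatten x k = x k - α x * v₀ k

    dot-flatten′ : ∀ r x → dot r (flatten x) ≈ dot r x - α x * dot r v₀
    dot-flatten′ r x = begin
      dot r (λ k → x k - α x * v₀ k)
        ≈⟨ dot-congˡ r (λ k → solve 3 (λ x a v → x :- a :* v := x :+ (:- a) :* v) refl (x k) (α x) (v₀ k)) ⟩
      dot r (λ k → x k + (- α x) * v₀ k)
        ≈⟨ dot-linear r x (- α x) v₀ ⟩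
      dot r x + (- α x) * dot r v₀
        ≈⟨ solve 3 (λ x a v → x :+ (:- a) :* v := x :- a :* v) refl (dot r x) (α x) (dot r v₀) ⟩
      dot r x - α x * dot r v₀ ∎

    dot-flatten : ∀ r x → dot r v₀ ≈ 0# → dot r (flatten x) ≈ dot r x
    dot-flatten r x r⊥v₀ = begin
      dot r (flatten x)           ≈⟨ dot-flatten′ r x ⟩
      dot r x - α x * dot r v₀    ≈⟨ +-congˡ (-‿cong (trans (*-congˡ r⊥v₀) (zeroʳ _))) ⟩
      dot r x - 0#                ≈⟨ solve 1 (λ x → x :- con (+ 0) := x) refl (dot r x) ⟩
      dot r x                     ∎

    flatten⊥v₀ : ∀ x → dot v₀ (flatten x) ≈ 0#
    flatten⊥v₀ x = begin
      dot v₀ (flatten x)                    ≈⟨ dot-flatten′ v₀ x ⟩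
      dot v₀ x - dot v₀ x * c * normSq v₀
        ≈⟨ solve 3 (λ x c q → x :- x :* c :* q := x :* (con (+ 1) :- q :* c)) refl (dot v₀ x) c (normSq v₀) ⟩
      dot v₀ x * ((1# + 0#) - normSq v₀ * c)
        ≈⟨ *-congˡ (+-cong (+-identityʳ 1#) (-‿cong v₀²c≈1)) ⟩
      dot v₀ x * (1# - 1#)                  ≈⟨ trans (*-congˡ (-‿inverseʳ 1#)) (zeroʳ _) ⟩
      0#                                    ∎

    module P = Projection (project (λ i → flatten (v (suc i))) (flatten b))
    s = P.residual

    s⊥v₀ : dot s v₀ ≈ 0#
    s⊥v₀ = begin
      dot s v₀                      ≈⟨ dot-comm s v₀ ⟩
      dot v₀ s                      ≈⟨ +-identityˡ _ ⟨
      0# + dot v₀ s                 ≈⟨ +-congʳ (trans (dot-comb v₀ P.weight (λ i → flatten (v (suc i))))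
                                         (sum-0 (λ i → trans (*-congˡ (flatten⊥v₀ (v (suc i)))) (zeroʳ _)))) ⟨
      dot v₀ y′ + dot v₀ s          ≈⟨ dot-+ v₀ y′ s ⟨
      dot v₀ (λ k → y′ k + s k)     ≈⟨ dot-congˡ v₀ P.splits ⟨
      dot v₀ (flatten b)            ≈⟨ flatten⊥v₀ b ⟩
      0#                            ∎
      where y′ = comb P.weight (λ i → flatten (v (suc i)))

    β = sum (λ i → P.weight i * α (v (suc i)))
    -- `α b` is the coefficient of `v₀` in `b`, and `β` is the share that the vectors `v (suc i)`
    -- bring back when they are no longer flattened.
    t = α b - β
    y = comb (t ∷ P.weight) v

    b-splits : ∀ k → b k ≈ y k + s k
    b-splits k = begin
      b k
        ≈⟨ solve 3 (λ b a v → b := (b :- a :* v) :+ a :* v) refl (b k) (α b) (v₀ k) ⟩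
      flatten b k + α b * v₀ k
        ≈⟨ +-congʳ (P.splits k) ⟩
      (comb P.weight (λ i → flatten (v (suc i))) k + s k) + α b * v₀ k
        ≈⟨ +-congʳ (+-congʳ (trans
             (sum-cong-≋ λ i → solve 4 (λ w x a v → w :* (x :- a :* v) := w :* x :+ (:- v) :* (w :* a)) refl
               (P.weight i) (v (suc i) k) (α (v (suc i))) (v₀ k))
             (sum-linear (- v₀ k) (λ i → P.weight i * v (suc i) k) (λ i → P.weight i * α (v (suc i)))))) ⟩
      ((comb P.weight (λ i → v (suc i)) k + (- v₀ k) * β) + s k) + α b * v₀ k
        ≈⟨ solve 5 (λ y v β s a → ((y :+ (:- v) :* β) :+ s) :+ a :* v := ((a :- β) :* v :+ y) :+ s) refl
             (comb P.weight (λ i → v (suc i)) k) (v₀ k) β (s k) (α b) ⟩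
      (t * v₀ k + comb P.weight (λ i → v (suc i)) k) + s k ∎

    s⊥y : dot s y ≈ 0#
    s⊥y = begin
      dot s y
        ≈⟨ dot-comb s (t ∷ P.weight) v ⟩
      t * dot s v₀ + sum (λ i → P.weight i * dot s (v (suc i)))
        ≈⟨ +-cong (trans (*-congˡ s⊥v₀) (zeroʳ t))
             (sum-cong-≋ (λ i → *-congˡ (sym (dot-flatten s (v (suc i)) s⊥v₀)))) ⟩
      0# + sum (λ i → P.weight i * dot s (flatten (v (suc i))))
        ≈⟨ +-identityˡ _ ⟩
      sum (λ i → P.weight i * dot s (flatten (v (suc i))))
        ≈⟨ dot-comb s P.weight (λ i → flatten (v (suc i))) ⟨
      dot s (comb P.weight (λ i → flatten (v (suc i))))
        ≈⟨ P.orthogonal ⟩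
      0# ∎

    x = comb Q.weight (λ i → v (suc i))

    -- If t ≤ 0, both residuals are at most as long as the other one, hence equal;
    -- but only one of them is orthogonal to v₀.
    t≥0 : 0# ≤ t
    t≥0 with total 0# t
    ... | inj₁ t≥0 = t≥0
    ... | inj₂ t≤0 = contradiction
      (≤-reflexive (trans (dot-cong {y = v₀} r≈s (λ _ → refl)) s⊥v₀)) rv₀>0
      where
      same : ∀ k → x k + Q.residual k ≈ y k + s k
      same k = trans (sym (Q.splits k)) (b-splits k)
      ry≤0 : dot Q.residual y ≤ 0#
      ry≤0 = ≤-respˡ (sym (dot-comb Q.residual (t ∷ P.weight) v)) (+-nonPos
        (≤-respˡ (*-comm _ t) (*-nonNeg-nonPos (<⇒≤ rv₀>0) t≤0))
        (sum-nonPos (λ i → *-nonNeg-nonPos (P.weight≥0 i) (Q.polar i))))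
      sx≤0 : dot s x ≤ 0#
      sx≤0 = dot-comb-nonPos s Q.weight _ Q.weight≥0
        (λ i → ≤-respˡ (dot-flatten s (v (suc i)) s⊥v₀) (P.polar i))
      r²≤s² : normSq Q.residual ≤ normSq s
      r²≤s² = ≤-trans
        (≤-respˡ (+-identityʳ _) (+-monoʳ-≤ _ (normSq-nonNeg (λ k → s k - Q.residual k))))
        (pythagoras-≤ y s x Q.residual (λ k → sym (same k)) Q.orthogonal ry≤0)
      r≈s : ∀ k → Q.residual k ≈ s k
      r≈s = closest-unique x Q.residual y s same s⊥y sx≤0 r²≤s²

  -- Gaussian elimination. With a pivot `p` for coordinate zero, the vectors `reduced i` vanish
  -- there and live in one dimension less; a dependence among them lifts once `v p` receives the
  -- weight `- β` that collects the subtracted multiples.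
  dependence : ∀ (v : Fin n → Vect D) → D ℕ.< n →
               ∃[ u ] ((∃[ i ] ¬ u i ≈ 0#) × (∀ k → comb u v k ≈ 0#))
  dependence {suc n} {zero} v _ = (λ _ → 1#) , (zero , λ 1≈0 → 1≰0 (≤-reflexive 1≈0)) , λ ()
  dependence {suc n} {suc D} v (s≤s D<n) with em {∃[ i ] ¬ v i zero ≈ 0#}
  ... | no none =
    let u , u≉0 , uv≈0 = dependence (λ i k → v i (suc k)) (ℕ.<-trans D<n (ℕ.n<1+n n))
    in u , u≉0 , λ { zero → sum-0 (λ i → trans (*-congˡ (vanish i)) (zeroʳ (u i))) ; (suc k) → uv≈0 k }
    where
    vanish : ∀ i → v i zero ≈ 0#
    vanish i with em {v i zero ≈ 0#}
    ... | yes vi≈0 = vi≈0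
    ... | no  vi≉0 = contradiction (i , vi≉0) none
  ... | yes (p , vp≉0) = u , u≉0 , uv≈0
    where
    c = proj₁ (inverse (v p zero) vp≉0)
    v′ : Fin n → Vect (suc D)
    v′ i = v (punchIn p i)
    reduced : Fin n → Vect (suc D)
    reduced i k = v′ i k - v′ i zero * c * v p k
    rec = dependence (λ i k → reduced i (suc k)) D<n
    u′ = proj₁ rec
    β = sum (λ i → u′ i * (v′ i zero * c))
    u = insertAt u′ p (- β)

    u≉0 : ∃[ i ] ¬ u i ≈ 0#
    u≉0 = let i , u′i≉0 = proj₁ (proj₂ rec)
          in punchIn p i , λ ui≈0 → u′i≉0 (trans (reflexive (≡.sym (insertAt-punchIn u′ p (- β) i))) ui≈0)

    reduced-comb : ∀ k → comb u′ reduced k ≈ 0#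
    reduced-comb zero = sum-0 λ i → begin
      u′ i * (v′ i zero - v′ i zero * c * v p zero)
        ≈⟨ solve 4 (λ u x c y → u :* (x :- x :* c :* y) := u :* x :* (con (+ 1) :- y :* c)) refl
             (u′ i) (v′ i zero) c (v p zero) ⟩
      u′ i * v′ i zero * ((1# + 0#) - v p zero * c)
        ≈⟨ *-congˡ (+-cong (+-identityʳ 1#) (-‿cong (proj₂ (inverse (v p zero) vp≉0)))) ⟩
      u′ i * v′ i zero * (1# - 1#)
        ≈⟨ trans (*-congˡ (-‿inverseʳ 1#)) (zeroʳ _) ⟩
      0# ∎
    reduced-comb (suc k) = proj₂ (proj₂ rec) k

    uv≈0 : ∀ k → comb u v k ≈ 0#
    uv≈0 k = begin
      comb u v k
        ≈⟨ sum-remove {i = p} (λ i → u i * v i k) ⟩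
      u p * v p k + sum (λ i → u (punchIn p i) * v′ i k)
        ≈⟨ +-cong (*-congʳ (reflexive (insertAt-lookup u′ p (- β))))
             (sum-cong-≋ (λ i → *-congʳ (reflexive (insertAt-punchIn u′ p (- β) i)))) ⟩
      - β * v p k + sum (λ i → u′ i * v′ i k)
        ≈⟨ solve 3 (λ b y z → (:- b) :* y :+ z := z :+ (:- y) :* b) refl β (v p k) (sum (λ i → u′ i * v′ i k)) ⟩
      sum (λ i → u′ i * v′ i k) + - v p k * β
        ≈⟨ sum-linear (- v p k) (λ i → u′ i * v′ i k) (λ i → u′ i * (v′ i zero * c)) ⟨
      sum (λ i → u′ i * v′ i k + - v p k * (u′ i * (v′ i zero * c)))
        ≈⟨ sum-cong-≋ (λ i → solve 5 (λ u x y z c →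
             u :* x :+ (:- y) :* (u :* (z :* c)) := u :* (x :- z :* c :* y)) refl
             (u′ i) (v′ i k) (v p k) (v′ i zero) c) ⟩
      comb u′ reduced k
        ≈⟨ reduced-comb k ⟩
      0# ∎

  -- The source of all extremal choices: the least ratio, the last edge of a boundary walk, the
  -- lowest valid edge, the lowest level that admits a path.
  argmin : ∀ (f : Vect n) (P : Fin n → Set) → ∃[ i ] P i → ∃[ i ] (P i × (∀ j → P j → f i ≤ f j))
  argmin {suc n} f P (i , Pi) with em {∃[ j ] P (suc j)}
  ... | no none = zero , head-only i Pi , λ
    { zero _ → ≤-refl ; (suc j) Pj → contradiction (j , Pj) none }
    where
    head-only : ∀ i → P i → P zero
    head-only zero    Pi = Pi
    head-only (suc i) Pi = contradiction (i , Pi) none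
  ... | yes some with argmin (λ j → f (suc j)) (λ j → P (suc j)) some
  ...   | j , Pj , min with em {P zero × f zero ≤ f (suc j)}
  ...     | yes (P0 , f0≤) = zero , P0 , λ { zero _ → ≤-refl ; (suc k) Pk → ≤-trans f0≤ (min k Pk) }
  ...     | no  not        = suc j , Pj , λ
    { zero P0 → ≰⇒≥ (λ f0≤ → not (P0 , f0≤)) ; (suc k) Pk → min k Pk }

  -- Junk value: recip 0 = 0.
  recip : Carrier → Carrier
  recip x with em {x ≈ 0#}
  ... | yes _   = 0#
  ... | no  x≉0 = proj₁ (inverse x x≉0)

  *-recip : ∀ {x} → ¬ x ≈ 0# → x * recip x ≈ 1#
  *-recip {x} x≉0 with em {x ≈ 0#}
  ... | yes x≈0 = contradiction x≈0 x≉0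
  ... | no  x≉0 = proj₂ (inverse x x≉0)

  ratio-cancels : ∀ x {y} → ¬ y ≈ 0# → x + - (x * recip y) * y ≈ 0#
  ratio-cancels x {y} y≉0 = begin
    x + - (x * recip y) * y
      ≈⟨ solve 3 (λ x c y → x :+ (:- (x :* c)) :* y := x :* (con (+ 1) :- y :* c)) refl x (recip y) y ⟩
    x * ((1# + 0#) - y * recip y)
      ≈⟨ *-congˡ (+-cong (+-identityʳ 1#) (-‿cong (*-recip y≉0))) ⟩
    x * (1# - 1#)
      ≈⟨ trans (*-congˡ (-‿inverseʳ 1#)) (zeroʳ _) ⟩
    0# ∎

  module RatioTest (y ρ : Vect n) (y≥0 : ∀ i → 0# ≤ y i) where
    -- The minimum ratio test of the simplex method. Where `ρ i` is negative, `ratio i` is the time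
    -- at which entry `i` of `y + s ρ` reaches zero; at the least of these times the ray is about to
    -- leave the orthant.
    ratio : Vect n
    ratio i = - (y i * recip (ρ i))

    module Minimum (k : Fin n) (ρk<0 : ρ k < 0#) (min : ∀ i → ρ i < 0# → ratio k ≤ ratio i) where
      s : Carrier
      s = ratio k

      hits : ∀ i → ρ i < 0# → y i + ratio i * ρ i ≈ 0#
      hits i ρi<0 = ratio-cancels (y i) (neg⇒≉0 ρi<0)

      s≥0 : 0# ≤ s
      s≥0 with total 0# s
      ... | inj₁ s≥0 = s≥0
      ... | inj₂ s≤0 = ≤-reflexive (sym (zero-product (trans (*-comm (ρ k) s) sρ≈0) (neg⇒≉0 ρk<0)))
        where
        sρ≈0 : s * ρ k ≈ 0#
        sρ≈0 = antisym
          (≤-respʳ (hits k ρk<0) (≤-respˡ (+-identityˡ _) (+-monoˡ-≤ (s * ρ k) (y≥0 k))))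
          (≤-respʳ (solve 2 (λ a b → (:- a) :* (:- b) := a :* b) refl s (ρ k))
            (*-nonNeg (neg-nonNeg s≤0) (neg-nonNeg (<⇒≤ ρk<0))))

      stays : ∀ i → 0# ≤ y i + s * ρ i
      stays i with em {ρ i < 0#}
      ... | no  ρi≮0 = +-nonNeg (y≥0 i) (*-nonNeg s≥0 (≮⇒≥ ρi≮0))
      ... | yes ρi<0 = ≤-respʳ
        (begin
          (ratio i - s) * - ρ i
            ≈⟨ +-identityˡ _ ⟨
          0# + (ratio i - s) * - ρ i
            ≈⟨ +-congʳ (hits i ρi<0) ⟨
          (y i + ratio i * ρ i) + (ratio i - s) * - ρ i
            ≈⟨ solve 4 (λ y a ρ s → (y :+ a :* ρ) :+ (a :- s) :* (:- ρ) := y :+ s :* ρ) refl (y i) (ratio i) (ρ i) s ⟩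
          y i + s * ρ i ∎)
        (*-nonNeg (x≤y⇒0≤y-x (min i ρi<0)) (neg-nonNeg (<⇒≤ ρi<0)))

  abstract
    ratioTest : ∀ (y ρ : Vect n) → (∀ i → 0# ≤ y i) → ∃[ i ] ρ i < 0# →
                ∃[ s ] ∃[ k ] (0# ≤ s × ρ k < 0# × (∀ i → 0# ≤ y i + s * ρ i) × y k + s * ρ k ≈ 0#)
    ratioTest y ρ y≥0 neg with k , ρk<0 , min ← argmin (RatioTest.ratio y ρ y≥0) (λ i → ρ i < 0#) neg =
      s , k , s≥0 , ρk<0 , stays , hits k ρk<0
      where open RatioTest.Minimum y ρ y≥0 k ρk<0 min

-- The polytope of nonnegative combinations of a fixed point

module ConeCombinations (em : ExcludedMiddle 0ℓ) (F : OrderedField) where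
  open OrderedField F
  open FieldOrder em F
  open LinearAlgebra em F
  open IntegerCoefficients commutativeRing
  open SemiringSum semiring using (sum; sum-cong-≋)
  open SetoidReasoning setoid

  private variable
    n D : ℕ

  Combination : (Fin n → Vect D) → Vect D → Vect n → Set
  Combination v y w = (∀ i → 0# ≤ w i) × (∀ k → comb w v k ≈ y k)

  -- Vectors of weight zero may be replaced freely; this is how a combination survives an exchange.
  comb-agree : ∀ {w : Vect n} {v v′ : Fin n → Vect D} →
               (∀ i → w i ≈ 0# ⊎ v i ≡ v′ i) → ∀ k → comb w v k ≈ comb w v′ k
  comb-agree {w = w} {v} {v′} agree k = sum-cong-≋ λ i → case i (agree i)
    where
    case : ∀ i → w i ≈ 0# ⊎ v i ≡ v′ i → w i * v i k ≈ w i * v′ i k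
    case i (inj₁ wi≈0)  = trans (trans (*-congʳ wi≈0) (zeroˡ _)) (sym (trans (*-congʳ wi≈0) (zeroˡ _)))
    case i (inj₂ vi≡v′i) = *-congˡ (reflexive (≡.cong (λ x → x k) vi≡v′i))

  shift : ∀ {v : Fin n → Vect D} {y w u} s → Combination v y w → (∀ k → comb u v k ≈ 0#) →
          (∀ i → 0# ≤ w i + s * u i) → Combination v y (λ i → w i + s * u i)
  shift {v = v} {y} {w} {u} s (_ , wv≈y) uv≈0 stays = stays , λ k → begin
    comb (λ i → w i + s * u i) v k    ≈⟨ comb-linear w s u v k ⟩
    comb w v k + s * comb u v k       ≈⟨ +-cong (wv≈y k) (trans (*-congˡ (uv≈0 k)) (zeroʳ s)) ⟩
    y k + 0#                          ≈⟨ +-identityʳ (y k) ⟩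
    y k                               ∎

  -- Complementary slackness: the terms `w i * dot r (v i)` are nonpositive and sum to `dot r y`,
  -- which is zero, so each of them vanishes.
  complementary : ∀ {v : Fin n → Vect D} {y w} r → Combination v y w → dot r y ≈ 0# →
                  (∀ i → ¬ w i ≈ 0# → dot r (v i) ≤ 0#) → ∀ i → ¬ w i ≈ 0# → dot r (v i) ≈ 0#
  complementary {v = v} {y} {w} r (w≥0 , wv≈y) r⊥y polar i =
    zero-product (nonPos-sum-zero terms≤0
      (≤-reflexive (trans (sym r⊥y) (trans (dot-congˡ r (λ k → sym (wv≈y k))) (dot-comb r w v)))) i)
    where
    terms≤0 : ∀ i → w i * dot r (v i) ≤ 0#
    terms≤0 i with em {w i ≈ 0#}
    ... | yes wi≈0 = ≤-reflexive (trans (*-congʳ wi≈0) (zeroˡ _))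
    ... | no  wi≉0 = *-nonNeg-nonPos (w≥0 i) (polar i wi≉0)

  -- Without a common zero, every entry has nonzero weight in `w` or in `w′`, so slackness for both
  -- covers all vectors.
  complementary₂ : ∀ {v : Fin n → Vect D} {y w w′} r → Combination v y w → Combination v y w′ → dot r y ≈ 0# →
                   (∀ i → dot r (v i) ≤ 0#) → (∀ i → w i ≈ 0# → ¬ w′ i ≈ 0#) → ∀ i → dot r (v i) ≈ 0#
  complementary₂ {w = w} r wv≈y w′v≈y r⊥y polar disjoint i with em {w i ≈ 0#}
  ... | no  wi≉0 = complementary r wv≈y r⊥y (λ i _ → polar i) i wi≉0
  ... | yes wi≈0 = complementary r w′v≈y r⊥y (λ i _ → polar i) i (disjoint i wi≈0)

  -- Replacing v j by r forces the j-th coefficient of a dependence to vanish,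
  -- as r is orthogonal to the other vectors.
  dependence-avoiding : ∀ (v : Fin n → Vect D) r j → D ℕ.< n → 0# < normSq r →
    (∀ i → i ≢ j → dot r (v i) ≈ 0#) →
    ∃[ u ] ((∃[ i ] ¬ u i ≈ 0#) × u j ≈ 0# × (∀ k → comb u v k ≈ 0#))
  dependence-avoiding {n} {D} v r j D<n r²>0 r⊥v = u , u≉0 , uj≈0 , λ k → trans (comb-agree agree k) (uv′≈0 k)
    where
    v′ = updateAt v j (const r)
    dep = dependence v′ D<n
    u = proj₁ dep
    u≉0 = proj₁ (proj₂ dep)
    uv′≈0 = proj₂ (proj₂ dep)

    off-j : ∀ i → i ≢ j → u i * dot r (v′ i) ≈ 0#
    off-j i i≢j = begin
      u i * dot r (v′ i)    ≡⟨ ≡.cong (λ x → u i * dot r x) (updateAt-minimal i j v i≢j) ⟩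
      u i * dot r (v i)     ≈⟨ trans (*-congˡ (r⊥v i i≢j)) (zeroʳ (u i)) ⟩
      0#                    ∎

    uj≈0 : u j ≈ 0#
    uj≈0 = zero-product (begin
      normSq r * u j                       ≈⟨ *-comm _ _ ⟩
      u j * dot r r                        ≡⟨ ≡.cong (λ x → u j * dot r x) (updateAt-updates j v) ⟨
      u j * dot r (v′ j)                   ≈⟨ sum-single j off-j ⟨
      sum (λ i → u i * dot r (v′ i))       ≈⟨ dot-comb r u v′ ⟨
      dot r (comb u v′)                    ≈⟨ dot-zeroʳ r uv′≈0 ⟩
      0#                                   ∎) (pos⇒≉0 r²>0)

    agree : ∀ i → u i ≈ 0# ⊎ v i ≡ v′ i
    agree i with i ≟ᶠ j
    ... | yes ≡.refl = inj₁ uj≈0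
    ... | no  i≢j    = inj₂ (≡.sym (updateAt-minimal i j v i≢j))

  -- A dependence without negative entries would pair with `e` to a zero sum of nonnegative terms,
  -- and so vanish. Geometrically, with entry `j` held fixed, the combinations of a point form a
  -- bounded set.
  has-negative : ∀ {v : Fin n → Vect D} {u} e j → (∀ i → i ≢ j → 0# < dot e (v i)) →
                 (∃[ i ] ¬ u i ≈ 0#) → u j ≈ 0# → (∀ k → comb u v k ≈ 0#) → ∃[ i ] u i < 0#
  has-negative {v = v} {u} e j e>0 (i , ui≉0) uj≈0 uv≈0 with em {∃[ i ] u i < 0#}
  ... | yes neg  = neg
  ... | no  none = contradiction (zero-product
      (trans (*-comm _ _) (nonNeg-sum-zero terms≥0
        (≤-reflexive (trans (sym (dot-comb e u v)) (dot-zeroʳ e uv≈0))) i))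
      (pos⇒≉0 (e>0 i i≢j))) ui≉0
    where
    i≢j : i ≢ j
    i≢j ≡.refl = ui≉0 uj≈0
    terms≥0 : ∀ i → 0# ≤ u i * dot e (v i)
    terms≥0 i with i ≟ᶠ j
    ... | yes ≡.refl = ≤-reflexive (sym (trans (*-congʳ uj≈0) (zeroˡ _)))
    ... | no  i≢j    = *-nonNeg (≮⇒≥ (λ ui<0 → none (i , ui<0))) (<⇒≤ (e>0 i i≢j))

  -- If no other weight vanishes, slackness puts the other n - 1 vectors into the hyperplane
  -- orthogonal to `r`. Its dimension D - 1 is too small for them to be independent, so there is a
  -- direction with `u j ≈ 0`; following it until a weight reaches zero gives `k`.
  second-zero : ∀ {v : Fin n → Vect D} {y w} r e j → D ℕ.< n → 0# < normSq r → dot r y ≈ 0# →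
    (∀ i → i ≢ j → dot r (v i) ≤ 0#) → (∀ i → i ≢ j → 0# < dot e (v i)) →
    Combination v y w → w j ≈ 0# →
    ∃[ k ] ∃[ w′ ] (k ≢ j × Combination v y w′ × w′ j ≈ 0# × w′ k ≈ 0#)
  second-zero {v = v} {y} {w} r e j D<n r²>0 r⊥y polar e>0 wv≈y wj≈0 with em {∃[ k ] (k ≢ j × w k ≈ 0#)}
  ... | yes (k , k≢j , wk≈0) = k , w , k≢j , wv≈y , wj≈0 , wk≈0
  ... | no  none = case dependence-avoiding v r j D<n r²>0 r⊥v of λ where
      (u , u≉0 , uj≈0 , uv≈0) →
       case ratioTest w u (proj₁ wv≈y) (has-negative {v = v} e j e>0 u≉0 uj≈0 uv≈0) of λ where
        (s , k , _ , uk<0 , stays , hit) →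
          k , (λ i → w i + s * u i) , (λ k≡j → neg⇒≉0 (≡.subst (λ k → u k < 0#) k≡j uk<0) uj≈0) ,
          shift s wv≈y uv≈0 stays ,
          trans (+-cong wj≈0 (trans (*-congˡ uj≈0) (zeroʳ s))) (+-identityˡ 0#) , hit
    where
    r⊥v : ∀ i → i ≢ j → dot r (v i) ≈ 0#
    r⊥v i i≢j = complementary r wv≈y r⊥y
      (λ i wi≉0 → polar i (λ { ≡.refl → wi≉0 wj≈0 })) i (λ wi≈0 → none (i , i≢j , wi≈0))

  -- In the polytope of combinations of `y`, the facets `j` and `k` meet. The two indices may
  -- coincide.
  JointZeros : (Fin n → Vect D) → Vect D → Fin n → Fin n → Set
  JointZeros v y j k = ∃[ w ] (Combination v y w × w j ≈ 0# × w k ≈ 0#)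

  -- In the plane through x and w₁ in direction u, walk along the boundary of the polytope of
  -- all w with Combination v y w: from x, on the edge where the i-th weight vanishes, towards
  -- w₁ + τ u, which lies beyond the edge containing w₁.
  module BoundaryWalk {n D : ℕ} {v : Fin n → Vect D} {y : Vect D} {u w₁ : Vect n} (uv≈0 : ∀ k → comb u v k ≈ 0#)
    (w₁v≈y : Combination v y w₁) (i₁ : Fin n) (ui₁<0 : u i₁ < 0#) (w₁i₁≈0 : w₁ i₁ ≈ 0#) where

    -- For `u i < 0`, the parameter at which the line from `w₁` in direction `u` crosses the i-th
    -- constraint. It measures the progress of the walk.
    τ : Vect n
    τ i = - (w₁ i * recip (u i))

    private
      module Step (i : Fin n) (ui<0 : u i < 0#) (x : Vect n) (xv≈y : Combination v y x) (xi≈0 : x i ≈ 0#)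
                  (w₁i≉0 : ¬ w₁ i ≈ 0#) (t : Carrier) (tight : w₁ i + t * u i ≈ 0#) where

        t>0 : 0# < t
        t>0 t≤0 = nonNeg∧≉0⇒pos (proj₁ w₁v≈y i) w₁i≉0 (≤-respʳ tight (≤-respˡ (+-identityʳ (w₁ i))
          (+-monoʳ-≤ (w₁ i) (≤-respʳ (solve 2 (λ a b → (:- a) :* (:- b) := a :* b) refl t (u i))
            (*-nonNeg (neg-nonNeg t≤0) (neg-nonNeg (<⇒≤ ui<0)))))))

        -1# = - (1# + 0#)

        ρ : Vect n
        ρ k = (w₁ k + -1# * x k) + t * u k

        x+ρ : ∀ k → x k + ρ k ≈ w₁ k + t * u k
        x+ρ k = solve 4 (λ x w t u → x :+ ((w :+ con -1ℤ :* x) :+ t :* u) := w :+ t :* u) refl (x k) (w₁ k) t (u k)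

        ρi≈0 : ρ i ≈ 0#
        ρi≈0 = begin
          ρ i                   ≈⟨ +-identityˡ (ρ i) ⟨
          0# + ρ i              ≈⟨ +-congʳ xi≈0 ⟨
          x i + ρ i             ≈⟨ x+ρ i ⟩
          w₁ i + t * u i        ≈⟨ tight ⟩
          0#                    ∎

        ρv≈0 : ∀ k → comb ρ v k ≈ 0#
        ρv≈0 k = begin
          comb ρ v k
            ≈⟨ comb-linear (λ k → w₁ k + -1# * x k) t u v k ⟩
          comb (λ k → w₁ k + -1# * x k) v k + t * comb u v k
            ≈⟨ +-cong (comb-linear w₁ -1# x v k) (*-congˡ (uv≈0 k)) ⟩
          (comb w₁ v k + -1# * comb x v k) + t * 0#
            ≈⟨ +-congʳ (+-cong (proj₂ w₁v≈y k) (*-congˡ (proj₂ xv≈y k))) ⟩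
          (y k + -1# * y k) + t * 0#
            ≈⟨ solve 2 (λ y t → (y :+ con -1ℤ :* y) :+ t :* con (+ 0) := con (+ 0)) refl (y k) t ⟩
          0# ∎

        beyond : x i₁ + ρ i₁ < 0#
        beyond 0≤ = *-pos-neg t>0 ui₁<0 (≤-respʳ (trans (x+ρ i₁) (trans (+-congʳ w₁i₁≈0) (+-identityˡ _))) 0≤)

        ρi₁<0 : ρ i₁ < 0#
        ρi₁<0 0≤ρi₁ = beyond (+-nonNeg (proj₁ xv≈y i₁) 0≤ρi₁)

        module Hit (s : Carrier) (k : Fin n) (ρk<0 : ρ k < 0#) (stays : ∀ i → 0# ≤ x i + s * ρ i)
                   (hit : x k + s * ρ k ≈ 0#) where

          s<1 : s < 1#
          s<1 1≤s = +-neg-nonPos beyond (*-nonNeg-nonPos (x≤y⇒0≤y-x 1≤s) (<⇒≤ ρi₁<0)) (≤-respʳ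
            (begin
              x i₁ + s * ρ i₁
                ≈⟨ solve 3 (λ x s ρ → x :+ s :* ρ := (x :+ ρ) :+ (s :- con (+ 1)) :* ρ) refl (x i₁) s (ρ i₁) ⟩
              (x i₁ + ρ i₁) + (s - (1# + 0#)) * ρ i₁
                ≈⟨ +-congˡ (*-congʳ (+-congˡ (-‿cong (+-identityʳ 1#)))) ⟩
              (x i₁ + ρ i₁) + (s - 1#) * ρ i₁ ∎)
            (stays i₁))

          violated : w₁ k + t * u k < 0#
          violated 0≤ = *-pos-neg {x = 1# - s} (λ 1-s≤0 → s<1 (0≤y-x⇒x≤y (≤-respʳ
              (solve 2 (λ a b → :- (a :- b) := b :- a) refl 1# s) (neg-nonNeg 1-s≤0)))) ρk<0
            (≤-respʳ (begin
              w₁ k + t * u k                               ≈⟨ x+ρ k ⟨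
              x k + ρ k
                ≈⟨ solve 3 (λ x s ρ → x :+ ρ := (x :+ s :* ρ) :+ (con (+ 1) :- s) :* ρ) refl (x k) s (ρ k) ⟩
              (x k + s * ρ k) + ((1# + 0#) - s) * ρ k      ≈⟨ +-cong hit (*-congʳ (+-congʳ (+-identityʳ 1#))) ⟩
              0# + (1# - s) * ρ k                          ≈⟨ +-identityˡ _ ⟩
              (1# - s) * ρ k                               ∎) 0≤)

          uk<0 : u k < 0#
          uk<0 0≤uk = violated (+-nonNeg (proj₁ w₁v≈y k) (*-nonNeg (<⇒≤ t>0) 0≤uk))

          τk<t : τ k < t
          τk<t t≤τk = violated (≤-respʳ
            (begin
              (τ k - t) * - u k
                ≈⟨ +-identityˡ _ ⟨
              0# + (τ k - t) * - u k
                ≈⟨ +-congʳ (ratio-cancels (w₁ k) (neg⇒≉0 uk<0)) ⟨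
              (w₁ k + τ k * u k) + (τ k - t) * - u k
                ≈⟨ solve 4 (λ w a u s → (w :+ a :* u) :+ (a :- s) :* (:- u) := w :+ s :* u) refl (w₁ k) (τ k) (u k) t ⟩
              w₁ k + t * u k ∎)
            (*-nonNeg (x≤y⇒0≤y-x t≤τk) (neg-nonNeg (<⇒≤ uk<0))))

          joint : JointZeros v y i k
          joint = (λ i → x i + s * ρ i) , shift s xv≈y ρv≈0 stays ,
            trans (+-cong xi≈0 (trans (*-congˡ ρi≈0) (zeroʳ s))) (+-identityˡ 0#) , hit

    -- The target on the line violates constraint `i₁`, so the walk along edge `i` stops before it,
    -- at some edge `k`. Past that point the k-th weight is negative, also at the target, whereas
    -- `w₁` satisfies constraint `k`. Hence the line from `w₁` crosses `k` before `i`.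
    next : ∀ i {x} → u i < 0# → Combination v y x → x i ≈ 0# → ¬ w₁ i ≈ 0# →
           ∃[ k ] (JointZeros v y i k × u k < 0# × τ k < τ i)
    next i {x} ui<0 xv≈y xi≈0 w₁i≉0 = conclude (ratioTest x ρ (proj₁ xv≈y) (i₁ , ρi₁<0))
      where
      open Step i ui<0 x xv≈y xi≈0 w₁i≉0 (τ i) (ratio-cancels (w₁ i) (neg⇒≉0 ui<0))
      conclude : ∃[ s ] ∃[ k ] (0# ≤ s × ρ k < 0# × (∀ i → 0# ≤ x i + s * ρ i) × x k + s * ρ k ≈ 0#) →
                 ∃[ k ] (JointZeros v y i k × u k < 0# × τ k < τ i)
      conclude (s , k , _ , ρk<0 , stays , hit) = k , joint , uk<0 , τk<t
        where open Hit s k ρk<0 stays hit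

    -- Instead of iterating `next`, take a reached edge with the least `τ`: there `next` would
    -- contradict minimality, which leaves only `w₁ k ≈ 0`.
    walk : ∀ {j} i {x} → Star (JointZeros v y) j i → u i < 0# → Combination v y x → x i ≈ 0# →
           ∃[ k ] (Star (JointZeros v y) j k × w₁ k ≈ 0#)
    walk {j} i {x} path ui<0 xv≈y xi≈0 =
      case argmin τ Reached (i , path , ui<0 , x , xv≈y , xi≈0) of λ where
        (k , (path , uk<0 , x , xv≈y , xk≈0) , min) → k , path , arrived k path uk<0 xv≈y xk≈0 min
      where
      Reached : Fin n → Set
      Reached k = Star (JointZeros v y) j k × u k < 0# × ∃[ x ] (Combination v y x × x k ≈ 0#)
      arrived : ∀ k {x} → Star (JointZeros v y) j k → u k < 0# → Combination v y x → x k ≈ 0# →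
             (∀ l → Reached l → τ k ≤ τ l) → w₁ k ≈ 0#
      arrived k path uk<0 xv≈y xk≈0 min with em {w₁ k ≈ 0#}
      ... | yes w₁k≈0 = w₁k≈0
      ... | no  w₁k≉0 = case next k uk<0 xv≈y xk≈0 w₁k≉0 of λ where
        (l , (z , zv≈y , zk≈0 , zl≈0) , ul<0 , τl<τk) → contradiction
          (min l (path ◅◅ ((z , zv≈y , zk≈0 , zl≈0) ◅ []) , ul<0 , z , zv≈y , zl≈0)) τl<τk

  -- `u j ≈ 0` will keep the start of the walk on facet `j`, and `u l ≤ 0` its end on facet `l`.
  -- Both signs of a dependence have a negative entry, so the sign is free to arrange the latter.
  kernel-direction : ∀ (v : Fin n → Vect D) r e j l → D ℕ.< n → 0# < normSq r →
    (∀ i → dot r (v i) ≈ 0#) → (∀ i → 0# < dot e (v i)) →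
    ∃[ u ] (u j ≈ 0# × u l ≤ 0# × (∀ k → comb u v k ≈ 0#) × ∃[ i ] u i < 0#)
  kernel-direction v r e j l D<n r²>0 r⊥v e>0 =
    case dependence-avoiding v r j D<n r²>0 (λ i _ → r⊥v i) of λ where
      (u , (i , ui≉0) , uj≈0 , uv≈0) → case total (u l) 0# of λ where
        (inj₁ ul≤0) → u , uj≈0 , ul≤0 , uv≈0 ,
          has-negative {v = v} e j (λ i _ → e>0 i) (i , ui≉0) uj≈0 uv≈0
        (inj₂ ul≥0) → (λ i → - u i) , neg-zero uj≈0 , neg-nonPos ul≥0 , comb-neg u uv≈0 ,
          has-negative {v = v} e j (λ i _ → e>0 i)
            (i , λ -ui≈0 → ui≉0 (trans (solve 1 (λ x → x := :- (:- x)) refl (u i)) (neg-zero -ui≈0)))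
            (neg-zero uj≈0) (comb-neg u uv≈0)
    where
    neg-zero : ∀ {x} → x ≈ 0# → - x ≈ 0#
    neg-zero x≈0 = trans (-‿cong x≈0) (solve 0 (:- con (+ 0) := con (+ 0)) refl)
    comb-neg : ∀ u → (∀ k → comb u v k ≈ 0#) → ∀ k → comb (λ i → - u i) v k ≈ 0#
    comb-neg u uv≈0 k = begin
      comb (λ i → - u i) v k
        ≈⟨ sum-cong-≋ (λ i → solve 2 (λ u x → (:- u) :* x := (con (+ 0) :+ con -1ℤ :* u) :* x) refl (u i) (v i k)) ⟩
      comb (λ i → 0# + (- (1# + 0#)) * u i) v k
        ≈⟨ comb-linear (λ _ → 0#) (- (1# + 0#)) u v k ⟩
      comb (λ _ → 0#) v k + (- (1# + 0#)) * comb u v k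
        ≈⟨ +-cong (sum-0 (λ i → zeroˡ (v i k))) (trans (*-congˡ (uv≈0 k)) (zeroʳ _)) ⟩
      0# + 0#
        ≈⟨ +-identityˡ 0# ⟩
      0# ∎

  -- A common zero `i` of `w` and `w′` gives the chain `j`, `i`, `l`. Otherwise all vectors are
  -- orthogonal to `r`, which leaves room for a direction `u`; pushing `w` and `w′` along it until
  -- they hit facets `i₀` and `i₁` yields the two ends of a planar boundary walk.
  joint-zeros-connected : ∀ {v : Fin n → Vect D} {y w w′} r e j l → D ℕ.< n → 0# < normSq r → dot r y ≈ 0# →
    (∀ i → dot r (v i) ≤ 0#) → (∀ i → 0# < dot e (v i)) →
    Combination v y w → w j ≈ 0# → Combination v y w′ → w′ l ≈ 0# → Star (JointZeros v y) j l
  joint-zeros-connected {v = v} {y} {w} {w′} r e j l D<n r²>0 r⊥y polar e>0 wv≈y wj≈0 w′v≈y w′l≈0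
    with em {∃[ i ] (w i ≈ 0# × w′ i ≈ 0#)}
  ... | yes (i , wi≈0 , w′i≈0) = (w , wv≈y , wj≈0 , wi≈0) ◅ (w′ , w′v≈y , w′i≈0 , w′l≈0) ◅ []
  ... | no  none = case kernel-direction v r e j l D<n r²>0 r⊥v e>0 of λ where
      (u , uj≈0 , ul≤0 , uv≈0 , u-neg) → along u uj≈0 ul≤0 uv≈0
        (ratioTest w u (proj₁ wv≈y) u-neg) (ratioTest w′ u (proj₁ w′v≈y) u-neg)
    where
    r⊥v : ∀ i → dot r (v i) ≈ 0#
    r⊥v = complementary₂ r wv≈y w′v≈y r⊥y polar (λ i wi≈0 w′i≈0 → none (i , wi≈0 , w′i≈0))

    Exit : Vect _ → Vect _ → Set
    Exit w u = ∃[ s ] ∃[ k ] (0# ≤ s × u k < 0# × (∀ i → 0# ≤ w i + s * u i) × w k + s * u k ≈ 0#)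

    along : ∀ u → u j ≈ 0# → u l ≤ 0# → (∀ k → comb u v k ≈ 0#) → Exit w u → Exit w′ u → Star (JointZeros v y) j l
    along u uj≈0 ul≤0 uv≈0 (s₀ , i₀ , _ , ui₀<0 , w₀≥0 , w₀i₀≈0) (s₁ , i₁ , s₁≥0 , ui₁<0 , w₁≥0 , w₁i₁≈0) =
      case BoundaryWalk.walk uv≈0 w₁v≈y i₁ ui₁<0 w₁i₁≈0 i₀
             ((_ , w₀v≈y , w₀j≈0 , w₀i₀≈0) ◅ []) ui₀<0 w₀v≈y w₀i₀≈0 of λ where
        (k , path , w₁k≈0) → path ◅◅ ((_ , w₁v≈y , w₁k≈0 , w₁l≈0) ◅ [])
      where
      w₀v≈y = shift {v = v} {y} {w} {u} s₀ wv≈y uv≈0 w₀≥0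
      w₁v≈y = shift {v = v} {y} {w′} {u} s₁ w′v≈y uv≈0 w₁≥0
      w₀j≈0 : w j + s₀ * u j ≈ 0#
      w₀j≈0 = trans (+-cong wj≈0 (trans (*-congˡ uj≈0) (zeroʳ s₀))) (+-identityˡ 0#)
      w₁l≈0 : w′ l + s₁ * u l ≈ 0#
      -- A weight that starts at zero, does not increase and is still nonnegative has stayed zero.
      w₁l≈0 = antisym (+-nonPos (≤-reflexive w′l≈0) (*-nonNeg-nonPos s₁≥0 ul≤0)) (w₁≥0 l)

-- Colourful tuples, heights of edges and the descent

module ColourfulCones (em : ExcludedMiddle 0ℓ) (F : OrderedField) where
  open OrderedField F
  open FieldOrder em F
  open LinearAlgebra em F
  open ConeCombinations em F
  open Projection

  -- `colour-meets` is the dual form of `b` lying in the cone of every colour: no vector separates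
  -- `b` from a colour. `e` is the homogenising functional.
  module Configuration {M n D : ℕ} (P : Fin M → Vect D) (C : Fin n → Fin M → Set) (b e : Vect D)
    (D<n : D ℕ.< n) (e>0 : ∀ q → 0# < dot e (P q))
    (colour-meets : ∀ i r → 0# < dot r b → ∃[ q ] (C i q × 0# < dot r (P q))) where

    record State : Set where
      field
        choice : Fin n → Fin M
        valid  : ∀ i → C i (choice i)
    open State

    points : (Fin n → Fin M) → Fin n → Vect D
    points c i = P (c i)

    -- A zero vector contributes nothing to a cone, and putting it in place of the entry keeps the
    -- index set `Fin n`.
    omit : (Fin n → Vect D) → Fin n → Fin n → Vect D
    omit v j = updateAt v j (const (λ _ → 0#))

    distance : (Fin n → Vect D) → Carrier
    distance v = normSq (residual (project v b))

    height : State → Carrier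
    height s = distance (points (choice s))

    edgeHeight : (Fin n → Fin M) → Fin n → Carrier
    edgeHeight c j = distance (omit (points c) j)

    AgreeOff : Fin n → State → State → Set
    AgreeOff j s t = ∀ i → i ≢ j → choice s i ≡ choice t i

    -- The height is read off `s`, but it sees only the entries other than `j`, which `t` shares.
    -- Idle steps are allowed.
    Step : (Carrier → Set) → State → State → Set
    Step T s t = ∃[ j ] (AgreeOff j s t × T (edgeHeight (choice s) j))

    Path : (Carrier → Set) → State → State → Set
    Path T = Star (Step T)

    Path-mono : ∀ {T U} → (∀ {h} → T h → U h) → ∀ {s t} → Path T s t → Path U s t
    Path-mono T⇒U = Star.map λ { (j , agree , Th) → j , agree , T⇒U Th }

    Splits : Vect D → Vect D → Set
    Splits y r = ∀ k → b k ≈ y k + r k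

    distance-≤ : ∀ {v y w r} → Combination v y w → Splits y r → distance v ≤ normSq r
    distance-≤ {v} {y} {w} {r} (w≥0 , wv≈y) split = ≤-trans
      (≤-respˡ (+-identityʳ _) (+-monoʳ-≤ _ (normSq-nonNeg (λ k → r k - residual Q k))))
      (pythagoras-≤ y r (comb (weight Q) v) (residual Q)
        (λ k → trans (sym (split k)) (splits Q k)) (orthogonal Q)
        (≤-respˡ (dot-congˡ (residual Q) wv≈y) (dot-comb-nonPos (residual Q) w v w≥0 (polar Q))))
      where Q = project v b

    residual-unique : ∀ {v y w r} → Combination v y w → Splits y r → normSq r ≤ distance v →
                      ∀ k → r k ≈ residual (project v b) k
    residual-unique {v} {y} {w} {r} (w≥0 , wv≈y) split r²≤ =
      closest-unique y r (comb (weight Q) v) (residual Q)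
        (λ k → trans (sym (split k)) (splits Q k)) (orthogonal Q)
        (≤-respˡ (dot-congˡ (residual Q) wv≈y) (dot-comb-nonPos (residual Q) w v w≥0 (polar Q))) r²≤
      where Q = project v b

    -- If the distance did not drop, uniqueness would make `r` the residual of the projection, and
    -- then it would be polar to `v i`.
    distance-< : ∀ {v y w r} i → Combination v y w → Splits y r → 0# < dot r (v i) → distance v < normSq r
    distance-< {v} i wv≈y split rv>0 r²≤ = rv>0 (≤-respˡ
      (sym (dot-cong {y = v i} (residual-unique wv≈y split r²≤) (λ _ → refl))) (polar (project v b) i))

    omit-self : ∀ v j → omit v j j ≡ (λ _ → 0#)
    omit-self v j = updateAt-updates j v

    omit-other : ∀ v {i j} → i ≢ j → omit v j i ≡ v i
    omit-other v {i} {j} i≢j = updateAt-minimal i j v i≢j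

    -- The point of the cone over the tuple s without its j-th entry that is closest to b.
    record Facet (s : State) (j : Fin n) (r : Vect D) : Set where
      field
        foot        : Vect D
        coefficient : Vect n
        combination : Combination (points (choice s)) foot coefficient
        vanishes    : coefficient j ≈ 0#
        split       : Splits foot r
        orthogonal′ : dot r foot ≈ 0#
        polar′      : ∀ i → i ≢ j → dot r (P (choice s i)) ≤ 0#
    open Facet

    facet : ∀ s j → Facet s j (residual (project (omit (points (choice s)) j) b))
    facet s j = record
      { foot        = comb (weight Q) (omit v j)
      ; coefficient = w
      ; combination = w≥0 , wv≈
      ; vanishes    = reflexive (updateAt-updates j (weight Q))
      ; split       = splits Q
      ; orthogonal′ = orthogonal Q
      ; polar′      = λ i i≢j → ≤-respˡ (reflexive (≡.cong (dot (residual Q)) (omit-other v i≢j))) (polar Q i)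
      }
      where
      v = points (choice s)
      Q = project (omit v j) b
      w : Vect n
      -- The projection may put any weight on the zero vector that stands at `j`; overwriting it by
      -- zero does not move the foot.
      w = updateAt (weight Q) j (const 0#)
      w≥0 : ∀ i → 0# ≤ w i
      w≥0 i with i ≟ᶠ j
      ... | yes ≡.refl = ≤-reflexive (sym (reflexive (updateAt-updates j (weight Q))))
      ... | no  i≢j    = ≤-respʳ (sym (reflexive (updateAt-minimal i j (weight Q) i≢j))) (weight≥0 Q i)
      wv≈ : ∀ k → comb w v k ≈ comb (weight Q) (omit v j) k
      wv≈ k = sum-cong-≋ term
        where
        open SemiringSum semiring using (sum-cong-≋)
        term : ∀ i → w i * v i k ≈ weight Q i * omit v j i k
        term i with i ≟ᶠ j
        ... | yes ≡.refl = trans (trans (*-congʳ (reflexive (updateAt-updates j (weight Q)))) (zeroˡ _))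
                             (sym (trans (*-congˡ (reflexive (≡.cong (λ x → x k) (omit-self v j)))) (zeroʳ _)))
        ... | no  i≢j    = *-cong (reflexive (updateAt-minimal i j (weight Q) i≢j))
                             (sym (reflexive (≡.cong (λ x → x k) (omit-other v i≢j))))

    comb-cong : ∀ {v v′ : Fin n → Vect D} {y w} → (∀ i → w i ≈ 0# ⊎ v i ≡ v′ i) → Combination v y w → Combination v′ y w
    comb-cong agree (w≥0 , wv≈y) = w≥0 , λ k → trans (sym (comb-agree agree k)) (wv≈y k)

    Facet-transport : ∀ {s t j r} → AgreeOff j s t → Facet s j r → Facet t j r
    Facet-transport {s} {t} {j} {r} agree f = record
      { foot        = foot f
      ; coefficient = coefficient f
      ; combination = comb-cong same (combination f)
      ; vanishes    = vanishes f
      ; split       = split f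
      ; orthogonal′ = orthogonal′ f
      ; polar′      = λ i i≢j → ≤-respˡ (reflexive (≡.cong (λ q → dot r (P q)) (agree i i≢j))) (polar′ f i i≢j)
      }
      where
      same : ∀ i → coefficient f i ≈ 0# ⊎ P (choice s i) ≡ P (choice t i)
      same i with i ≟ᶠ j
      ... | yes ≡.refl = inj₁ (vanishes f)
      ... | no  i≢j    = inj₂ (≡.cong P (agree i i≢j))

    height-≤ : ∀ {s j r} → Facet s j r → height s ≤ normSq r
    height-≤ f = distance-≤ (combination f) (split f)

    dot-r-b : ∀ {y r} → Splits y r → dot r y ≈ 0# → dot r b ≈ normSq r
    dot-r-b {y} {r} split r⊥y = trans (dot-congˡ r split)
      (trans (dot-+ r y r) (trans (+-congʳ r⊥y) (+-identityˡ _)))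

    replace : ∀ (s : State) j q → C j q → State
    replace s j q Cq = record { choice = c ; valid = λ i → valid′ i }
      where
      c = updateAt (choice s) j (const q)
      valid′ : ∀ i → C i (c i)
      valid′ i with i ≟ᶠ j
      ... | yes ≡.refl = ≡.subst (C i) (≡.sym (updateAt-updates i (choice s))) Cq
      ... | no  i≢j    = ≡.subst (C i) (≡.sym (updateAt-minimal i j (choice s) i≢j)) (valid s i)

    replace-self : ∀ s j q Cq → choice (replace s j q Cq) j ≡ q
    replace-self s j q Cq = updateAt-updates j (choice s)

    replace-other : ∀ s {i j} q Cq → i ≢ j → choice (replace s j q Cq) i ≡ choice s i
    replace-other s {i} {j} q Cq i≢j = updateAt-minimal i j (choice s) i≢j

    -- Exchanges and detours below the level of an edge

    Exchanged : Vect D → State → Fin n → State → Set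
    Exchanged r s j t = AgreeOff j s t × 0# < dot r (P (choice t j))

    exchange : ∀ {r} → 0# < dot r b → ∀ s j → ∃[ t ] Exchanged r s j t
    exchange {r} rb>0 s j with q , Cq , rq>0 ← colour-meets j r rb>0 =
      replace s j q Cq , (λ i i≢j → ≡.sym (replace-other s q Cq i≢j)) ,
      ≡.subst (λ q → 0# < dot r (P q)) (≡.sym (replace-self s j q Cq)) rq>0

    Exchanged-resp : ∀ {r r′ s j t} → (∀ k → r k ≈ r′ k) → Exchanged r s j t → Exchanged r′ s j t
    Exchanged-resp {s = s} {j} {t} r≈r′ (agree , rt>0) = agree , λ r′t≤0 →
      rt>0 (≤-respˡ (sym (dot-cong {y = P (choice t j)} r≈r′ (λ _ → refl))) r′t≤0)

    -- The combination uses neither `j` nor `k`, so its point lies in the cone of `t` without `k`,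
    -- whatever stands at `k`. That cone also contains the new entry at `j`, on the positive side of
    -- `r`, and therefore comes strictly closer to `b`.
    edgeHeight-< : ∀ {s t j k y w r} → j ≢ k → Combination (points (choice s)) y w → w j ≈ 0# → w k ≈ 0# →
                   Splits y r → (∀ i → i ≢ j → i ≢ k → choice s i ≡ choice t i) → 0# < dot r (P (choice t j)) →
                   edgeHeight (choice t) k < normSq r
    edgeHeight-< {s} {t} {j} {k} {w = w} {r} j≢k wv≈y wj≈0 wk≈0 split agree rt>0 =
      distance-< j (comb-cong same wv≈y) split
        (≡.subst (λ x → 0# < dot r x) (≡.sym (omit-other (points (choice t)) j≢k)) rt>0)
      where
      same : ∀ i → w i ≈ 0# ⊎ P (choice s i) ≡ omit (points (choice t)) k i
      same i with i ≟ᶠ j | i ≟ᶠ k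
      ... | yes ≡.refl | _          = inj₁ wj≈0
      ... | no  _      | yes ≡.refl = inj₁ wk≈0
      ... | no  i≢j    | no  i≢k    = inj₂ (≡.trans (≡.cong P (agree i i≢j i≢k)) (≡.sym (omit-other _ i≢k)))

    -- The intermediate state `mid` carries both exchanges. Each of the two steps omits one
    -- exchanged entry while the other one lowers the edge.
    link : ∀ {s t t′ j k y w r} → j ≢ k → Combination (points (choice s)) y w → w j ≈ 0# → w k ≈ 0# →
           Splits y r → Exchanged r s j t → Exchanged r s k t′ → Path (_< normSq r) t t′
    link {s} {t} {t′} {j} {k} {r = r} j≢k wv≈y wj≈0 wk≈0 split (agree , rt>0) (agree′ , rt′>0) =
      _◅_ {j = mid} (k , (λ i i≢k → ≡.sym (replace-other t q Cq i≢k)) ,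
        edgeHeight-< {s} {t} j≢k wv≈y wj≈0 wk≈0 split (λ i i≢j _ → agree i i≢j) rt>0)
      ((j , mid-agree ,
        edgeHeight-< {s} {mid} (j≢k ∘ ≡.sym) wv≈y wk≈0 wj≈0 split
          (λ i i≢k i≢j → ≡.trans (agree i i≢j) (≡.sym (replace-other t q Cq i≢k)))
          (≡.subst (λ q → 0# < dot r (P q)) (≡.sym (replace-self t k q Cq)) rt′>0)) ◅ [])
      where
      q = choice t′ k
      Cq = valid t′ k
      mid : State
      mid = replace t k q Cq
      mid-agree : AgreeOff j mid t′
      mid-agree i i≢j with i ≟ᶠ k
      ... | yes ≡.refl = replace-self t k q Cq
      ... | no  i≢k    = ≡.trans (replace-other t q Cq i≢k) (≡.trans (≡.sym (agree i i≢j)) (agree′ i i≢k))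

    -- The direct edge from `t` to `t′` omits `j` and has height exactly `normSq r`, which is too
    -- high. The detour goes through an exchange at a second entry `k` of weight zero.
    relink : ∀ {s t t′ j r} → Facet s j r → 0# < normSq r →
             Exchanged r s j t → Exchanged r s j t′ → Path (_< normSq r) t t′
    relink {s} {t} {t′} {j} {r} f r²>0 t-ex t′-ex =
      case second-zero r e j D<n r²>0 (orthogonal′ f) (polar′ f) (λ i _ → e>0 (choice s i))
             (combination f) (vanishes f) of λ where
        (k , w , k≢j , wv≈y , wj≈0 , wk≈0) →
          case exchange {r} (<-≤-trans r²>0 (≤-reflexive (sym (dot-r-b (split f) (orthogonal′ f))))) s k of λ where
            (u , u-ex) → link {s} {t} {u} (k≢j ∘ ≡.sym) wv≈y wj≈0 wk≈0 (split f) t-ex u-ex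
                     ◅◅ link {s} {u} {t′} k≢j wv≈y wk≈0 wj≈0 (split f) u-ex t′-ex

    -- Rerouting a path strictly below its highest level

    module Lowering (h : Carrier) (h>0 : 0# < h) where

      -- A state below the level may stay; a state on it gives way to an exchange. As `height s` is
      -- at most `normSq r`, the second case forces both of them to be `h`.
      Representative : State → State → Set
      Representative s t =
        (height s < h × t ≡ s) ⊎
        (h ≤ height s × ∃[ j ] ∃[ r ] (Facet s j r × normSq r ≤ h × Exchanged r s j t))

      -- On the level, uniqueness identifies both residuals with that of `s`. So both facets belong
      -- to the polytope over the same foot `y₀`, and a chain of meeting facets turns into a chain
      -- of links.
      representatives-connected : ∀ {s t t′} → Representative s t → Representative s t′ → Path (_< h) t t′
      representatives-connected (inj₁ (_ , ≡.refl)) (inj₁ (_ , ≡.refl)) = []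
      representatives-connected (inj₁ (s<h , _))    (inj₂ (h≤s , _))    = contradiction h≤s s<h
      representatives-connected (inj₂ (h≤s , _))    (inj₁ (s<h , _))    = contradiction h≤s s<h
      representatives-connected {s} {t} {t′} (inj₂ (h≤s , j , r , f , r²≤h , t-ex))
                                             (inj₂ (_ , l , r′ , f′ , r′²≤h , t′-ex)) =
        Path-mono {_< normSq r₀} (λ x<r → <-≤-trans x<r r₀²≤h)
          (relink (facet₀ f r²≤h) r₀²>0 (Exchanged-resp {s = s} {j} {t} (r≈r₀ f r²≤h) t-ex) (proj₂ (canonical j))
          ◅◅ chain (joint-zeros-connected r₀ e j l D<n r₀²>0 (orthogonal Q) (polar Q) (λ i → e>0 (choice s i))
               (combination (facet₀ f r²≤h)) (vanishes f) (combination (facet₀ f′ r′²≤h)) (vanishes f′))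
          ◅◅ relink (facet₀ f′ r′²≤h) r₀²>0 (proj₂ (canonical l)) (Exchanged-resp {s = s} {l} {t′} (r≈r₀ f′ r′²≤h) t′-ex))
        where
        v = points (choice s)
        Q = project v b
        r₀ = residual Q
        y₀ = comb (weight Q) v

        r₀²>0 : 0# < normSq r₀
        r₀²>0 = <-≤-trans h>0 h≤s

        r₀²≤h : normSq r₀ ≤ h
        r₀²≤h = ≤-trans (height-≤ f) r²≤h

        r≈r₀ : ∀ {j r} (f : Facet s j r) → normSq r ≤ h → ∀ k → r k ≈ r₀ k
        r≈r₀ f r²≤h = residual-unique (combination f) (split f) (≤-trans r²≤h h≤s)

        facet₀ : ∀ {j r} → Facet s j r → normSq r ≤ h → Facet s j r₀
        facet₀ {j} {r} f r²≤h = record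
          { foot        = y₀
          ; coefficient = coefficient f
          ; combination = proj₁ (combination f) , λ k → trans (proj₂ (combination f) k) (foot≈y₀ k)
          ; vanishes    = vanishes f
          ; split       = splits Q
          ; orthogonal′ = orthogonal Q
          ; polar′      = λ i _ → polar Q i
          }
          where
          open IntegerCoefficients commutativeRing
          foot≈y₀ : ∀ k → foot f k ≈ y₀ k
          foot≈y₀ k = trans (solve 2 (λ y r → y := (y :+ r) :- r) refl (foot f k) (r k))
            (trans (+-cong (trans (sym (split f k)) (splits Q k)) (-‿cong (r≈r₀ f r²≤h k)))
              (solve 2 (λ y r → (y :+ r) :- r := y) refl (y₀ k) (r₀ k)))

        -- One fixed exchange per entry lets consecutive links join up; `relink` passes between it
        -- and the given exchange at either end.
        canonical : ∀ i → ∃[ t ] Exchanged r₀ s i t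
        canonical = exchange (<-≤-trans r₀²>0 (≤-reflexive (sym (dot-r-b (splits Q) (orthogonal Q))))) s

        chain : ∀ {i l} → Star (JointZeros v y₀) i l → Path (_< normSq r₀) (proj₁ (canonical i)) (proj₁ (canonical l))
        chain [] = []
        chain {i} (_◅_ {j = k} (w , wv≈y , wi≈0 , wk≈0) rest) with i ≟ᶠ k
        ... | yes ≡.refl = chain rest
        ... | no  i≢k    = link {s} i≢k wv≈y wi≈0 wk≈0 (splits Q) (proj₂ (canonical i)) (proj₂ (canonical k)) ◅◅ chain rest

      -- A state below the level counts as its own exchange: were its entry at `j` not on the
      -- positive side of `r`, then `r` would be polar to the whole tuple and `height s` at least
      -- `normSq r`.
      exchanged-representative : ∀ {s j r} → Facet s j r → normSq r ≤ h → h ≤ normSq r →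
                                 ∃[ t ] (Representative s t × Exchanged r s j t)
      exchanged-representative {s} {j} {r} f r²≤h h≤r² with em {h ≤ height s}
      ... | no  s<h = s , inj₁ (s<h , ≡.refl) , (λ _ _ → ≡.refl) , λ rs≤0 →
        s<h (≤-trans h≤r² (≤-trans
          (≤-respˡ (+-identityʳ _) (+-monoʳ-≤ _ (normSq-nonNeg (λ k → residual Q k - r k))))
          (pythagoras-≤ (comb (weight Q) v) (residual Q) (foot f) r
            (λ k → trans (sym (splits Q k)) (split f k)) (orthogonal′ f)
            (dot-comb-nonPos r (weight Q) v (weight≥0 Q) (all-polar rs≤0)))))
        where
        v = points (choice s)
        Q = project v b
        all-polar : dot r (P (choice s j)) ≤ 0# → ∀ i → dot r (v i) ≤ 0#
        all-polar rs≤0 i with i ≟ᶠ j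
        ... | yes ≡.refl = rs≤0
        ... | no  i≢j    = polar′ f i i≢j
      ... | yes h≤s = case exchange {r} rb>0 s j of λ where
          (t , t-ex) → t , inj₂ (h≤s , j , r , f , r²≤h , t-ex) , t-ex
        where
        rb>0 : 0# < dot r b
        rb>0 = <-≤-trans h>0 (≤-trans h≤r² (≤-reflexive (sym (dot-r-b (split f) (orthogonal′ f)))))

      -- The endpoints of an edge on the level share its facet and residual, so their
      -- representatives are two exchanges of one entry, which `relink` joins. The endpoints of a
      -- lower edge are no higher than the edge and represent themselves.
      step-representatives : ∀ {s s′} → Step (_≤ h) s s′ →
        ∃[ t ] ∃[ t′ ] (Representative s t × Representative s′ t′ × Path (_< h) t t′)
      step-representatives {s} {s′} (j , agree , E≤h) with em {h ≤ edgeHeight (choice s) j}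
      ... | no  E<h = s , s′ , inj₁ (≤-<-trans (height-≤ f) E<h , ≡.refl) ,
                      inj₁ (≤-<-trans (height-≤ (Facet-transport {s} {s′} agree f)) E<h , ≡.refl) , (j , agree , E<h) ◅ []
        where f = facet s j
      ... | yes h≤E = case exchanged-representative f E≤h h≤E of λ where
          (t , t-rep , t-ex) → case exchanged-representative (Facet-transport agree f) E≤h h≤E of λ where
            (t′ , t′-rep , agree′ , rt′>0) → t , t′ , t-rep , t′-rep ,
              Path-mono {_< edgeHeight (choice s) j} (λ x<r → <-≤-trans x<r E≤h)
                (relink f (<-≤-trans h>0 h≤E) t-ex
                  ((λ i i≢j → ≡.trans (agree i i≢j) (agree′ i i≢j)) , rt′>0))
        where f = facet s j

      lower : ∀ {s s′ t t′} → Representative s t → Path (_≤ h) s s′ → Representative s′ t′ → Path (_< h) t t′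
      lower s-rep [] s′-rep = representatives-connected s-rep s′-rep
      lower s-rep (s→u ◅ path) s′-rep = case step-representatives s→u of λ where
        (_ , _ , s-rep′ , u-rep , t→t′) →
          representatives-connected s-rep s-rep′ ◅◅ t→t′ ◅◅ lower u-rep path s′-rep

    -- Finitely many levels and the extremal arguments

    edgeHeight-resp-≤ : ∀ {c c′} j → c ≗ c′ → edgeHeight c j ≤ edgeHeight c′ j
    edgeHeight-resp-≤ {c} {c′} j c≗c′ = distance-≤
      (comb-cong (λ i → inj₂ (same i)) (weight≥0 Q , λ _ → refl)) (splits Q)
      where
      Q = project (omit (points c′) j) b
      same : ∀ i → omit (points c′) j i ≡ omit (points c) j i
      same i with i ≟ᶠ j
      ... | yes ≡.refl = ≡.trans (omit-self (points c′) j) (≡.sym (omit-self (points c) j))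
      ... | no  i≢j    = ≡.trans (omit-other (points c′) i≢j)
                           (≡.trans (≡.cong P (≡.sym (c≗c′ i))) (≡.sym (omit-other (points c) i≢j)))

    -- A finite code, so that minima over edges exist. Some codes stand for invalid choices:
    -- `connected` uses them only as thresholds, and `inhabited` filters them out. Decoding returns
    -- a choice up to pointwise equality, hence `edgeHeight-resp-≤`.
    Edge : Set
    Edge = Fin (M ℕ.^ n ℕ.* n)

    edge : (Fin n → Fin M) → Fin n → Edge
    edge c j = combine (funToFin c) j

    ends : Edge → (Fin n → Fin M) × Fin n
    ends η = finToFun (proj₁ (remQuot n η)) , proj₂ (remQuot {M ℕ.^ n} n η)

    level : Edge → Carrier
    level η = edgeHeight (proj₁ (ends η)) (proj₂ (ends η))

    ends-edge : ∀ c j → ∃[ c′ ] (c′ ≗ c × ends (edge c j) ≡ (c′ , j))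
    ends-edge c j = finToFun (funToFin c) , finToFun-funToFin c ,
      ≡.cong (λ (a , j) → finToFun a , j) (remQuot-combine (funToFin c) j)

    level-edge : ∀ c j → level (edge c j) ≈ edgeHeight c j
    level-edge c j with c′ , c′≗c , eq ← ends-edge c j = trans
      (reflexive (≡.cong (λ (c , j) → edgeHeight c j) eq))
      (antisym (edgeHeight-resp-≤ j c′≗c) (edgeHeight-resp-≤ j (λ i → ≡.sym (c′≗c i))))

    index₀ : Fin n
    index₀ = fromℕ< (ℕ.≤-<-trans z≤n D<n)

    -- Entries are replaced from the last to the first; in `go`, `m` counts those still to be
    -- treated.
    unrestricted : ∀ {T} → (∀ c j → T (edgeHeight c j)) → ∀ s t → Path T s t
    unrestricted {T} all s t = go n ℕ.≤-refl s (λ i n≤i → contradiction (ℕ.<-≤-trans (toℕ<n i) n≤i) (ℕ.<-irrefl ≡.refl))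
      where
      go : ∀ m → m ℕ.≤ n → ∀ s → (∀ i → m ℕ.≤ toℕ i → choice s i ≡ choice t i) → Path T s t
      -- `s` and `t` agree pointwise here but need not be equal states, so a last step closes the
      -- path.
      go zero    _   s agree = (index₀ , (λ i _ → agree i z≤n) , all _ _) ◅ []
      go (suc m) m<n s agree =
        (j , (λ i i≢j → ≡.sym (replace-other s q (valid t j) i≢j)) , all _ _) ◅ go m (ℕ.<⇒≤ m<n) s′ agree′
        where
        j = fromℕ< m<n
        q = choice t j
        s′ = replace s j q (valid t j)
        agree′ : ∀ i → m ℕ.≤ toℕ i → choice s′ i ≡ choice t i
        agree′ i m≤i with i ≟ᶠ j
        ... | yes ≡.refl = replace-self s j q (valid t j)
        ... | no  i≢j    = ≡.trans (replace-other s q (valid t j) i≢j)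
          (agree i (ℕ.≤∧≢⇒< m≤i (λ m≡i → i≢j (toℕ-injective (≡.trans (≡.sym m≡i) (≡.sym (toℕ-fromℕ< m<n)))))))

    -- Trades the open bound `h` for the level of an actual edge below `h`, to which minimality
    -- among finitely many levels applies.
    highest-edge : ∀ {h s t} → Path (_< h) s t → s ≡ t ⊎ ∃[ η ] (level η < h × Path (_≤ level η) s t)
    highest-edge [] = inj₁ ≡.refl
    highest-edge {s = s} (_◅_ {j = u} (j , agree , E<h) path) = inj₂ (extend (highest-edge path))
      where
      η₁ = edge (choice s) j
      E≤ : edgeHeight (choice s) j ≤ level η₁
      E≤ = ≤-reflexive (sym (level-edge (choice s) j))
      η₁<h = ≤-<-trans (≤-reflexive (level-edge (choice s) j)) E<h
      extend : ∀ {t} → u ≡ t ⊎ ∃[ η ] (level η < _ × Path (_≤ level η) u t) →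
               ∃[ η ] (level η < _ × Path (_≤ level η) s t)
      extend (inj₁ ≡.refl) = η₁ , η₁<h , (j , agree , E≤) ◅ []
      extend (inj₂ (η₂ , η₂<h , path)) with total (level η₁) (level η₂)
      ... | inj₁ η₁≤η₂ = η₂ , η₂<h , (j , agree , ≤-trans E≤ η₁≤η₂) ◅ path
      ... | inj₂ η₂≤η₁ = η₁ , η₁<h , (j , agree , E≤) ◅ Path-mono {_≤ level η₂} (λ x≤ → ≤-trans x≤ η₂≤η₁) path

    connected : ∀ s t → height s ≤ 0# → height t ≤ 0# → Path (_≤ 0#) s t
    connected s t s≤0 t≤0 =
      -- Minimising `- level` yields the highest level `top`. It admits every path, so the second
      -- minimum ranges over a nonempty set of levels.
      case argmin (λ η → - level η) (λ _ → ⊤) (edge (choice s) index₀ , tt) of λ where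
        (top , _ , max) → case argmin level (λ η → Path (_≤ level η) s t)
                                 (top , unrestricted {_≤ level top} (below-top top max) s t) of λ where
          (η , path , min) → descend η path min
      where
      below-top : ∀ top → (∀ η → ⊤ → - level top ≤ - level η) → ∀ c j → edgeHeight c j ≤ level top
      below-top top max c j = ≤-respˡ (level-edge c j) (0≤y-x⇒x≤y (≤-respʳ
        (solve 2 (λ a b → (:- a) :- (:- b) := b :- a) refl (level (edge c j)) (level top)) (x≤y⇒0≤y-x (max (edge c j) tt))))
        where open IntegerCoefficients commutativeRing

      descend : ∀ η → Path (_≤ level η) s t → (∀ η′ → Path (_≤ level η′) s t → level η ≤ level η′) → Path (_≤ 0#) s t
      descend η₀ path min with em {level η₀ ≤ 0#}
      ... | yes η₀≤0 = Path-mono {_≤ level η₀} (λ x≤ → ≤-trans x≤ η₀≤0) path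
      ... | no  η₀>0 = case highest-edge (lower (rep s≤0) path (rep t≤0)) of λ where
          (inj₁ ≡.refl) → []
          (inj₂ (η′ , η′<η₀ , path′)) → contradiction (min η′ path′) η′<η₀
        where
        open Lowering (level η₀) η₀>0
        rep : ∀ {s} → height s ≤ 0# → Representative s s
        rep s≤0 = inj₁ (≤-<-trans s≤0 η₀>0 , ≡.refl)

    -- Bárány's argument: at an edge of minimal but positive height, `second-zero` frees an entry
    -- `k` besides the omitted `j`, and exchanging `k` makes the edge at `j` lower.
    inhabited : State → ∃[ s ] ∃[ j ] edgeHeight (choice s) j ≤ 0#
    inhabited s₀ = case argmin level Valid (edge (choice s₀) index₀ , valid-edge s₀ index₀) of λ where
        (η , η-valid , min) →
          let s = record { choice = proj₁ (ends η) ; valid = η-valid } ; j = proj₂ (ends η) in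
          s , j , minimal s j (λ t k → ≤-respʳ (level-edge (choice t) k) (min (edge (choice t) k) (valid-edge t k)))
      where
      Valid : Edge → Set
      Valid η = ∀ i → C i (proj₁ (ends η) i)

      valid-edge : ∀ s j → Valid (edge (choice s) j)
      valid-edge s j i with c′ , c′≗c , eq ← ends-edge (choice s) j =
        ≡.subst (λ (c , _) → C i (c i)) (≡.sym eq) (≡.subst (C i) (≡.sym (c′≗c i)) (valid s i))

      minimal : ∀ s j → (∀ t k → edgeHeight (choice s) j ≤ edgeHeight (choice t) k) → edgeHeight (choice s) j ≤ 0#
      minimal s j min with em {edgeHeight (choice s) j ≤ 0#}
      ... | yes E≤0 = E≤0
      ... | no  E>0 = case improve of λ (t , k , t<s) → contradiction (min t k) t<s
        where
        f = facet s j
        r = residual (project (omit (points (choice s)) j) b)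
        improve : ∃[ t ] ∃[ k ] edgeHeight (choice t) k < edgeHeight (choice s) j
        improve = case second-zero r e j D<n E>0 (orthogonal′ f) (polar′ f) (λ i _ → e>0 (choice s i))
                         (combination f) (vanishes f) of λ where
          (k , w , k≢j , wv≈y , wj≈0 , wk≈0) →
            case exchange {r} (<-≤-trans E>0 (≤-reflexive (sym (dot-r-b (split f) (orthogonal′ f))))) s k of λ where
              (t , agree , rt>0) → t , j , edgeHeight-< {s} {t} k≢j wv≈y wk≈0 wj≈0 (split f) (λ i i≢k _ → agree i i≢k) rt>0

    -- The residual itself is the test vector: it is polar to the tuple, and its product with `b` is
    -- its squared norm.
    height-zero : ∀ {s} → (∀ r → (∀ i → dot r (P (choice s i)) ≤ 0#) → dot r b ≤ 0#) → height s ≤ 0#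
    height-zero {s} b∈cone = ≤-respˡ (dot-r-b (splits Q) (orthogonal Q)) (b∈cone (residual Q) (polar Q))
      where Q = project (points (choice s)) b

    edge-combination : ∀ s j → edgeHeight (choice s) j ≤ 0# →
                       ∃[ w ] (Combination (points (choice s)) b w × w j ≈ 0#)
    edge-combination s j E≤0 = coefficient f ,
      (proj₁ (combination f) , λ k → trans (proj₂ (combination f) k)
        (sym (trans (split f k) (trans (+-congˡ (normSq-zero E≤0 k)) (+-identityʳ _))))) , vanishes f
      where f = facet s j

open import Defs

-- The Cauchy reals as an ordered field

module RealField (em : ExcludedMiddle 0ℓ) where
  open +-*-Solver using (solve; con; _:=_; _:+_; _:*_; _:-_; :-_)

  eventually-∧ : ∀ {P Q : ℕ → Set} → Eventually P → Eventually Q → Eventually (λ n → P n × Q n)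
  eventually-∧ (M , p) (N , q) = M ⊔ N , λ n n≥ → p n (ℕ.m⊔n≤o⇒m≤o M N n≥) , q n (ℕ.m⊔n≤o⇒n≤o M N n≥)

  eventually-map : ∀ {P Q : ℕ → Set} → (∀ n → P n → Q n) → Eventually P → Eventually Q
  eventually-map f (N , p) = N , λ n n≥ → f n (p n n≥)

  eventually-≡ : ∀ {x y} → Eventually (λ n → seq x n ≡ seq y n) → x ≈ y
  eventually-≡ {x} {y} ev = mk≈ λ ε ε>0 → eventually-map
    (λ n eq → ≡.subst (λ q → ∣ seq x n ℚ.- q ∣ ℚ.< ε) eq (∣p-p∣<ε (seq x n) ε>0)) ev

  pointwise-≡ : ∀ {x y} → (∀ n → seq x n ≡ seq y n) → x ≈ y
  pointwise-≡ eq = eventually-≡ (0 , λ n _ → eq n)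

  abstract
    neg-isCauchy : ∀ x → IsCauchy (λ n → ℚ.- seq x n)
    neg-isCauchy x ε ε>0 = case isCauchy x ε ε>0 of λ where
      (N , close) → N , λ m n m≥ n≥ → ≡.subst (ℚ._< ε)
        (≡.trans (≡.sym (ℚ.∣-p∣≡∣p∣ (seq x m ℚ.- seq x n)))
          (≡.cong ∣_∣ (solve 2 (λ a b → :- (a :- b) := (:- a) :- (:- b)) ≡.refl (seq x m) (seq x n))))
        (close m n m≥ n≥)

  -ℝ_ : ℝ → ℝ
  -ℝ x = mkℝ (λ n → ℚ.- seq x n) (neg-isCauchy x)

  +-cong : ∀ {x x′ y y′} → x ≈ x′ → y ≈ y′ → x + y ≈ x′ + y′
  +-cong {x} {x′} {y} {y′} (mk≈ x≈) (mk≈ y≈) = mk≈ λ ε ε>0 → eventually-map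
    (λ n (xc , yc) → ∣+∣-split ε
      (solve 4 (λ a b c d → (a :+ b) :- (c :+ d) := (a :- c) :+ (b :- d)) ≡.refl
        (seq x n) (seq y n) (seq x′ n) (seq y′ n)) xc yc)
    (eventually-∧ (x≈ (½ ℚ.* ε) (½ε>0 ε ε>0)) (y≈ (½ ℚ.* ε) (½ε>0 ε ε>0)))

  -cong : ∀ {x x′} → x ≈ x′ → -ℝ x ≈ -ℝ x′
  -cong {x} {x′} (mk≈ x≈) = mk≈ λ ε ε>0 → eventually-map
    (λ n → ≡.subst (ℚ._< ε)
      (≡.trans (≡.sym (ℚ.∣-p∣≡∣p∣ (seq x n ℚ.- seq x′ n)))
        (≡.cong ∣_∣ (solve 2 (λ a b → :- (a :- b) := (:- a) :- (:- b)) ≡.refl (seq x n) (seq x′ n)))))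
    (x≈ ε ε>0)

  *-cong : ∀ {x x′ y y′} → x ≈ x′ → y ≈ y′ → x * y ≈ x′ * y′
  *-cong {x} {x′} {y} {y′} (mk≈ x≈) (mk≈ y≈) = mk≈ λ ε ε>0 →
    let B , B>0 , x≤B = bounded x
        C , C>0 , y≤C = bounded y′
        δ , δ>0 , Bδ≡ = tolerance B ε B>0 ε>0
        η , η>0 , Cη≡ = tolerance C ε C>0 ε>0
    in eventually-map
         (λ n ((x≤ , y≤) , (xc , yc)) →
           ∣*∣-difference {seq x n} {seq y n} {seq x′ n} {seq y′ n} ε B>0 C>0 Bδ≡ Cη≡ x≤ y≤ yc xc)
         (eventually-∧ (eventually-∧ x≤B y≤C) (eventually-∧ (x≈ η η>0) (y≈ δ δ>0)))

  +-assoc : ∀ x y z → (x + y) + z ≈ x + (y + z)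
  +-assoc x y z = pointwise-≡ λ n → ℚ.+-assoc (seq x n) (seq y n) (seq z n)

  +-comm : ∀ x y → x + y ≈ y + x
  +-comm x y = pointwise-≡ λ n → ℚ.+-comm (seq x n) (seq y n)

  +-identityˡ : ∀ x → 0ℝ + x ≈ x
  +-identityˡ x = pointwise-≡ λ n → ℚ.+-identityˡ (seq x n)

  +-identityʳ : ∀ x → x + 0ℝ ≈ x
  +-identityʳ x = pointwise-≡ λ n → ℚ.+-identityʳ (seq x n)

  +-inverseˡ : ∀ x → (-ℝ x) + x ≈ 0ℝ
  +-inverseˡ x = pointwise-≡ λ n → ℚ.+-inverseˡ (seq x n)

  +-inverseʳ : ∀ x → x + (-ℝ x) ≈ 0ℝ
  +-inverseʳ x = pointwise-≡ λ n → ℚ.+-inverseʳ (seq x n)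

  *-assoc : ∀ x y z → (x * y) * z ≈ x * (y * z)
  *-assoc x y z = pointwise-≡ λ n → ℚ.*-assoc (seq x n) (seq y n) (seq z n)

  *-comm : ∀ x y → x * y ≈ y * x
  *-comm x y = pointwise-≡ λ n → ℚ.*-comm (seq x n) (seq y n)

  *-identityˡ : ∀ x → 1ℝ * x ≈ x
  *-identityˡ x = pointwise-≡ λ n → ℚ.*-identityˡ (seq x n)

  *-identityʳ : ∀ x → x * 1ℝ ≈ x
  *-identityʳ x = pointwise-≡ λ n → ℚ.*-identityʳ (seq x n)

  *-distribˡ-+ : ∀ x y z → x * (y + z) ≈ x * y + x * z
  *-distribˡ-+ x y z = pointwise-≡ λ n → ℚ.*-distribˡ-+ (seq x n) (seq y n) (seq z n)

  *-distribʳ-+ : ∀ x y z → (y + z) * x ≈ y * x + z * x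
  *-distribʳ-+ x y z = pointwise-≡ λ n → ℚ.*-distribʳ-+ (seq x n) (seq y n) (seq z n)

  ℝ-commutativeRing : CommutativeRing 0ℓ 0ℓ
  ℝ-commutativeRing = record
    { Carrier = ℝ
    ; _≈_ = _≈_
    ; _+_ = _+_
    ; _*_ = _*_
    ; -_  = -ℝ_
    ; 0#  = 0ℝ
    ; 1#  = 1ℝ
    ; isCommutativeRing = record
      { isRing = record
        { +-isAbelianGroup = record
          { isGroup = record
            { isMonoid = record
              { isSemigroup = record
                { isMagma = record
                  { isEquivalence = Setoid.isEquivalence ℝ-setoid
                  ; ∙-cong = +-cong
                  }
                ; assoc = +-assoc
                }
              ; identity = +-identityˡ , +-identityʳ
              }
            ; inverse = +-inverseˡ , +-inverseʳ
            ; ⁻¹-cong = -cong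
            }
          ; comm = +-comm
          }
        ; *-cong = *-cong
        ; *-assoc = *-assoc
        ; *-identity = *-identityˡ , *-identityʳ
        ; distrib = *-distribˡ-+ , *-distribʳ-+
        }
      ; *-comm = *-comm
      }
    }

  p≤∣p∣ : ∀ p → p ℚ.≤ ∣ p ∣
  p≤∣p∣ p with ℚ.≤-total 0ℚ p
  ... | inj₁ 0≤p = ℚ.≤-reflexive (≡.sym (ℚ.0≤p⇒∣p∣≡p 0≤p))
  ... | inj₂ p≤0 = ℚ.≤-trans p≤0 (ℚ.0≤∣p∣ p)

  ∣p-q∣<ε⇒p<q+ε : ∀ p q {ε} → ∣ p ℚ.- q ∣ ℚ.< ε → p ℚ.< q ℚ.+ ε
  ∣p-q∣<ε⇒p<q+ε p q {ε} close = begin-strict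
    p                   ≡⟨ solve 2 (λ p q → p := q :+ (p :- q)) ≡.refl p q ⟩
    q ℚ.+ (p ℚ.- q)     ≤⟨ ℚ.+-monoʳ-≤ q (p≤∣p∣ (p ℚ.- q)) ⟩
    q ℚ.+ ∣ p ℚ.- q ∣   <⟨ ℚ.+-monoʳ-< q close ⟩
    q ℚ.+ ε             ∎
    where open ℚ.≤-Reasoning

  p<q+ε⇒p-q<ε : ∀ p q {ε} → p ℚ.< q ℚ.+ ε → p ℚ.- q ℚ.< ε
  p<q+ε⇒p-q<ε p q {ε} p< = begin-strict
    p ℚ.- q             <⟨ ℚ.+-monoˡ-< (ℚ.- q) p< ⟩
    (q ℚ.+ ε) ℚ.- q     ≡⟨ solve 2 (λ q ε → (q :+ ε) :- q := ε) ≡.refl q ε ⟩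
    ε                   ∎
    where open ℚ.≤-Reasoning

  p<p+ε : ∀ p {ε} → 0ℚ ℚ.< ε → p ℚ.< p ℚ.+ ε
  p<p+ε p {ε} ε>0 = ≡.subst (ℚ._< p ℚ.+ ε) (ℚ.+-identityʳ p) (ℚ.+-monoʳ-< p ε>0)

  ≤-reflexive : ∀ {x y} → x ≈ y → x ≤ y
  ≤-reflexive {x} {y} (mk≈ x≈y) = mk≤ λ ε ε>0 →
    eventually-map (λ n → ∣p-q∣<ε⇒p<q+ε (seq x n) (seq y n)) (x≈y ε ε>0)

  ≤-trans : ∀ {x y z} → x ≤ y → y ≤ z → x ≤ z
  ≤-trans {x} {y} {z} (mk≤ x≤y) (mk≤ y≤z) = mk≤ λ ε ε>0 → eventually-map
    (λ n (x< , y<) → let open ℚ.≤-Reasoning in begin-strict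
      seq x n                                     <⟨ x< ⟩
      seq y n ℚ.+ ½ ℚ.* ε                         <⟨ ℚ.+-monoˡ-< (½ ℚ.* ε) y< ⟩
      (seq z n ℚ.+ ½ ℚ.* ε) ℚ.+ ½ ℚ.* ε           ≡⟨ ℚ.+-assoc (seq z n) (½ ℚ.* ε) (½ ℚ.* ε) ⟩
      seq z n ℚ.+ (½ ℚ.* ε ℚ.+ ½ ℚ.* ε)           ≡⟨ ≡.cong (seq z n ℚ.+_) (halves ε) ⟩
      seq z n ℚ.+ ε                               ∎)
    (eventually-∧ (x≤y (½ ℚ.* ε) (½ε>0 ε ε>0)) (y≤z (½ ℚ.* ε) (½ε>0 ε ε>0)))

  ≤-antisym : ∀ {x y} → x ≤ y → y ≤ x → x ≈ y
  ≤-antisym {x} {y} (mk≤ x≤y) (mk≤ y≤x) = mk≈ λ ε ε>0 → eventually-map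
    (λ n (x< , y<) → case ℚ.∣p∣≡p∨∣p∣≡-p (seq x n ℚ.- seq y n) of λ where
      (inj₁ eq) → ≡.subst (ℚ._< ε) (≡.sym eq) (p<q+ε⇒p-q<ε (seq x n) (seq y n) x<)
      (inj₂ eq) → ≡.subst (ℚ._< ε)
        (≡.trans (solve 2 (λ a b → b :- a := :- (a :- b)) ≡.refl (seq x n) (seq y n)) (≡.sym eq))
        (p<q+ε⇒p-q<ε (seq y n) (seq x n) y<))
    (eventually-∧ (x≤y ε ε>0) (y≤x ε ε>0))

  -- ¬ x ≤ y yields a gap δ at infinitely many indices, and being Cauchy turns
  -- it into a gap δ/2 at all large indices.
  separated : ∀ {x y} → ¬ x ≤ y → ∃[ δ ] (0ℚ ℚ.< δ × Eventually λ n → seq y n ℚ.+ δ ℚ.< seq x n)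
  separated {x} {y} x≰y with em {∃[ δ ] (0ℚ ℚ.< δ × ¬ Eventually λ n → seq x n ℚ.< seq y n ℚ.+ δ)}
  ... | no none = contradiction (mk≤ below′) x≰y
    where
    below′ : ∀ ε → 0ℚ ℚ.< ε → Eventually λ n → seq x n ℚ.< seq y n ℚ.+ ε
    below′ ε ε>0 with em {Eventually λ n → seq x n ℚ.< seq y n ℚ.+ ε}
    ... | yes ev  = ev
    ... | no  ¬ev = contradiction (ε , ε>0 , ¬ev) none
  ... | yes (δ , δ>0 , ¬ev) = ½ ℚ.* δ , ½ε>0 δ δ>0 , N , gap
    where
    ¼δ = ½ ℚ.* (½ ℚ.* δ)
    ¼δ>0 = ½ε>0 (½ ℚ.* δ) (½ε>0 δ δ>0)
    Nx = isCauchy x ¼δ ¼δ>0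
    Ny = isCauchy y ¼δ ¼δ>0
    N = proj₁ Nx ⊔ proj₁ Ny

    far : ∃[ m ] (N ℕ.≤ m × seq y m ℚ.+ δ ℚ.≤ seq x m)
    far with em {∃[ m ] (N ℕ.≤ m × seq y m ℚ.+ δ ℚ.≤ seq x m)}
    ... | yes found = found
    ... | no  none  = contradiction
      (N , λ m m≥ → ℚ.≰⇒> (λ y+δ≤x → none (m , m≥ , y+δ≤x))) ¬ev

    gap : ∀ n → N ℕ.≤ n → seq y n ℚ.+ ½ ℚ.* δ ℚ.< seq x n
    gap n n≥ = case far of λ (m , m≥ , y+δ≤x) → let open ℚ.≤-Reasoning in begin-strict
      seq y n ℚ.+ ½ ℚ.* δ
        <⟨ ℚ.+-monoˡ-< (½ ℚ.* δ) (∣p-q∣<ε⇒p<q+ε (seq y n) (seq y m) (proj₂ Ny n m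
             (ℕ.m⊔n≤o⇒n≤o (proj₁ Nx) _ n≥) (ℕ.m⊔n≤o⇒n≤o (proj₁ Nx) _ m≥))) ⟩
      (seq y m ℚ.+ ¼δ) ℚ.+ ½ ℚ.* δ
        ≡⟨ solve 2 (λ y δ → (y :+ con ½ :* (con ½ :* δ)) :+ con ½ :* δ :=
             (y :+ δ) :- con ½ :* (con ½ :* δ)) ≡.refl (seq y m) δ ⟩
      (seq y m ℚ.+ δ) ℚ.- ¼δ
        ≤⟨ ℚ.+-monoˡ-≤ (ℚ.- ¼δ) y+δ≤x ⟩
      seq x m ℚ.- ¼δ
        <⟨ ℚ.+-monoˡ-< (ℚ.- ¼δ) (∣p-q∣<ε⇒p<q+ε (seq x m) (seq x n) (proj₂ Nx m n
             (ℕ.m⊔n≤o⇒m≤o (proj₁ Nx) _ m≥) (ℕ.m⊔n≤o⇒m≤o (proj₁ Nx) _ n≥))) ⟩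
      (seq x n ℚ.+ ¼δ) ℚ.- ¼δ
        ≡⟨ solve 2 (λ x q → (x :+ q) :- q := x) ≡.refl (seq x n) ¼δ ⟩
      seq x n ∎

  eventually-<⇒≤ : ∀ {x y} → Eventually (λ n → seq x n ℚ.< seq y n) → x ≤ y
  eventually-<⇒≤ {x} {y} ev = mk≤ λ ε ε>0 →
    eventually-map (λ n x<y → ℚ.<-trans x<y (p<p+ε (seq y n) ε>0)) ev

  ≤-total : ∀ x y → x ≤ y ⊎ y ≤ x
  ≤-total x y with em {x ≤ y}
  ... | yes x≤y = inj₁ x≤y
  ... | no  x≰y = case separated x≰y of λ where
    (δ , δ>0 , ev) → inj₂ (eventually-<⇒≤ (eventually-map (λ n → ℚ.<-trans (p<p+ε (seq y n) δ>0)) ev))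

  +-monoʳ-≤ : ∀ x {y z} → y ≤ z → x + y ≤ x + z
  +-monoʳ-≤ x {y} {z} (mk≤ y≤z) = mk≤ λ ε ε>0 → eventually-map
    (λ n y< → ≡.subst (seq x n ℚ.+ seq y n ℚ.<_) (≡.sym (ℚ.+-assoc (seq x n) (seq z n) ε))
      (ℚ.+-monoʳ-< (seq x n) y<))
    (y≤z ε ε>0)

  open CommutativeRing ℝ-commutativeRing using (zeroˡ; zeroʳ)

  eventually-positive : ∀ {x} → ¬ x ≤ 0ℝ → ∃[ δ ] (0ℚ ℚ.< δ × Eventually λ n → δ ℚ.< seq x n)
  eventually-positive {x} x≰0 = case separated x≰0 of λ where
    (δ , δ>0 , ev) → δ , δ>0 , eventually-map (λ n → ≡.subst (ℚ._< seq x n) (ℚ.+-identityˡ δ)) ev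

  -- A nonnegative real may have negative terms, so signs cannot be multiplied termwise. But either
  -- some factor is zero, or both sequences are eventually positive.
  *-nonNeg : ∀ {x y} → 0ℝ ≤ x → 0ℝ ≤ y → 0ℝ ≤ x * y
  *-nonNeg {x} {y} x≥0 y≥0 with em {x ≤ 0ℝ} | em {y ≤ 0ℝ}
  ... | yes x≤0 | _       = ≤-reflexive (≈-sym (≈-trans (*-cong (≤-antisym x≤0 x≥0) ≈-refl) (zeroˡ y)))
  ... | no  _   | yes y≤0 = ≤-reflexive (≈-sym (≈-trans (*-cong {x} {x} ≈-refl (≤-antisym y≤0 y≥0)) (zeroʳ x)))
  ... | no  x≰0 | no  y≰0 = eventually-<⇒≤ (eventually-map
      (λ n (x> , y>) → ℚ.positive⁻¹ _ {{ℚ.pos*pos⇒pos (seq x n) {{ℚ.positive x>}} (seq y n) {{ℚ.positive y>}}}})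
      (eventually-∧ (positive′ x≰0) (positive′ y≰0)))
    where
    positive′ : ∀ {x} → ¬ x ≤ 0ℝ → Eventually λ n → 0ℚ ℚ.< seq x n
    positive′ x≰0 = case eventually-positive x≰0 of λ where
      (δ , δ>0 , ev) → eventually-map (λ n → ℚ.<-trans δ>0) ev

  -- Junk value: recipℚ 0 = 0.
  recipℚ : ℚ → ℚ
  recipℚ p with p ℚ.≟ 0ℚ
  ... | yes _   = 0ℚ
  ... | no  p≢0 = ℚ.1/_ p {{ℚ.≢-nonZero p≢0}}

  *-recipℚ : ∀ {p} → 0ℚ ℚ.< p → p ℚ.* recipℚ p ≡ 1ℚ
  *-recipℚ {p} p>0 with p ℚ.≟ 0ℚ
  ... | yes p≡0 = contradiction p>0 (ℚ.<-irrefl (≡.sym p≡0))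
  ... | no  p≢0 = ℚ.*-inverseʳ p {{ℚ.≢-nonZero p≢0}}

  recipℚ-pos : ∀ {p} → 0ℚ ℚ.< p → 0ℚ ℚ.< recipℚ p
  recipℚ-pos {p} p>0 with p ℚ.≟ 0ℚ
  ... | yes p≡0 = contradiction p>0 (ℚ.<-irrefl (≡.sym p≡0))
  ... | no  p≢0 = ℚ.positive⁻¹ _ {{ℚ.1/pos⇒pos p {{ℚ.positive p>0}}}}

  recipℚ-antitone : ∀ {p q} → 0ℚ ℚ.< p → p ℚ.≤ q → recipℚ q ℚ.≤ recipℚ p
  recipℚ-antitone {p} {q} p>0 p≤q = begin
    recipℚ q                                ≡⟨ ℚ.*-identityˡ (recipℚ q) ⟨
    1ℚ ℚ.* recipℚ q                         ≡⟨ ≡.cong (ℚ._* recipℚ q) (*-recipℚ p>0) ⟨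
    p ℚ.* recipℚ p ℚ.* recipℚ q             ≡⟨ ℚ.*-assoc p (recipℚ p) (recipℚ q) ⟩
    p ℚ.* (recipℚ p ℚ.* recipℚ q)
      ≤⟨ ℚ.*-monoʳ-≤-nonNeg (recipℚ p ℚ.* recipℚ q) {{ℚ.pos⇒nonNeg (recipℚ p ℚ.* recipℚ q) {{ℚ.pos*pos⇒pos (recipℚ p)
           {{ℚ.positive (recipℚ-pos p>0)}} (recipℚ q) {{ℚ.positive (recipℚ-pos q>0)}}}}}} p≤q ⟩
    q ℚ.* (recipℚ p ℚ.* recipℚ q)
      ≡⟨ solve 3 (λ q a b → q :* (a :* b) := a :* (q :* b)) ≡.refl q (recipℚ p) (recipℚ q) ⟩
    recipℚ p ℚ.* (q ℚ.* recipℚ q)           ≡⟨ ≡.cong (recipℚ p ℚ.*_) (*-recipℚ q>0) ⟩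
    recipℚ p ℚ.* 1ℚ                         ≡⟨ ℚ.*-identityʳ (recipℚ p) ⟩
    recipℚ p                                ∎
    where
    open ℚ.≤-Reasoning
    q>0 = ℚ.<-≤-trans p>0 p≤q

  recipℚ-difference : ∀ {p q} → 0ℚ ℚ.< p → 0ℚ ℚ.< q →
                      recipℚ p ℚ.- recipℚ q ≡ recipℚ p ℚ.* recipℚ q ℚ.* (q ℚ.- p)
  recipℚ-difference {p} {q} p>0 q>0 = ≡.sym (begin
    a ℚ.* b ℚ.* (q ℚ.- p)
      ≡⟨ solve 4 (λ a b q p → a :* b :* (q :- p) := a :* (q :* b) :- b :* (p :* a)) ≡.refl a b q p ⟩
    a ℚ.* (q ℚ.* b) ℚ.- b ℚ.* (p ℚ.* a)
      ≡⟨ ≡.cong₂ (λ s t → a ℚ.* s ℚ.- b ℚ.* t) (*-recipℚ q>0) (*-recipℚ p>0) ⟩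
    a ℚ.* 1ℚ ℚ.- b ℚ.* 1ℚ
      ≡⟨ ≡.cong₂ ℚ._-_ (ℚ.*-identityʳ a) (ℚ.*-identityʳ b) ⟩
    a ℚ.- b ∎)
    where
    open ≡.≡-Reasoning
    a = recipℚ p
    b = recipℚ q

  -- The terms are eventually above some `δ > 0`, where the reciprocal has Lipschitz constant
  -- `c * c` with `c = recipℚ δ`; this sets the tolerance. Earlier terms may be zero, hence the
  -- total `recipℚ`.
  positive-inverse : ∀ x → ¬ x ≤ 0ℝ → ∃[ y ] x * y ≈ 1ℝ
  positive-inverse x x≰0 = case eventually-positive x≰0 of λ where
      (δ , δ>0 , ev) → mkℝ (λ n → recipℚ (seq x n)) (cauchy δ δ>0 ev) ,
        eventually-≡ (eventually-map (λ n δ<x → *-recipℚ (ℚ.<-trans δ>0 δ<x)) ev)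
    where
    cauchy : ∀ δ → 0ℚ ℚ.< δ → Eventually (λ n → δ ℚ.< seq x n) → IsCauchy (λ n → recipℚ (seq x n))
    cauchy δ δ>0 (N , δ<x) ε ε>0 =
      let c = recipℚ δ
          c²>0 = ℚ.positive⁻¹ (c ℚ.* c) {{ℚ.pos*pos⇒pos c {{ℚ.positive (recipℚ-pos δ>0)}} c {{ℚ.positive (recipℚ-pos δ>0)}}}}
          η , η>0 , c²η≡ = tolerance (c ℚ.* c) ε c²>0 ε>0
          K , close = isCauchy x η η>0
      in N ⊔ K , λ m n m≥ n≥ →
        let m≥N = ℕ.m⊔n≤o⇒m≤o N K m≥
            n≥N = ℕ.m⊔n≤o⇒m≤o N K n≥
            xm>0 = ℚ.<-trans δ>0 (δ<x m m≥N)
            xn>0 = ℚ.<-trans δ>0 (δ<x n n≥N)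
            open ℚ.≤-Reasoning
        in begin-strict
          ∣ recipℚ (seq x m) ℚ.- recipℚ (seq x n) ∣
            ≡⟨ ≡.cong ∣_∣ (recipℚ-difference xm>0 xn>0) ⟩
          ∣ recipℚ (seq x m) ℚ.* recipℚ (seq x n) ℚ.* (seq x n ℚ.- seq x m) ∣
            <⟨ ∣*∣-bound {recipℚ (seq x m) ℚ.* recipℚ (seq x n)} {seq x n ℚ.- seq x m} c²>0
                 (product-bound δ>0 (ℚ.<⇒≤ (δ<x m m≥N)) (ℚ.<⇒≤ (δ<x n n≥N)))
                 (close n m (ℕ.m⊔n≤o⇒n≤o N K n≥) (ℕ.m⊔n≤o⇒n≤o N K m≥)) ⟩
          c ℚ.* c ℚ.* η
            ≡⟨ c²η≡ ⟩
          ½ ℚ.* ε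
            <⟨ p<p+ε (½ ℚ.* ε) (½ε>0 ε ε>0) ⟩
          ½ ℚ.* ε ℚ.+ ½ ℚ.* ε
            ≡⟨ halves ε ⟩
          ε ∎
      where
      product-bound : ∀ {δ p q} → 0ℚ ℚ.< δ → δ ℚ.≤ p → δ ℚ.≤ q →
                      ∣ recipℚ p ℚ.* recipℚ q ∣ ℚ.≤ recipℚ δ ℚ.* recipℚ δ
      product-bound {δ} {p} {q} δ>0 δ≤p δ≤q = begin
        ∣ a ℚ.* b ∣        ≡⟨ ℚ.0≤p⇒∣p∣≡p (ℚ.<⇒≤ (ℚ.positive⁻¹ _ {{ℚ.pos*pos⇒pos a {{ℚ.positive a>0}} b {{ℚ.positive b>0}}}})) ⟩
        a ℚ.* b            ≤⟨ ℚ.*-monoʳ-≤-nonNeg b {{ℚ.nonNegative (ℚ.<⇒≤ b>0)}} (recipℚ-antitone δ>0 δ≤p) ⟩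
        c ℚ.* b            ≤⟨ ℚ.*-monoˡ-≤-nonNeg c {{ℚ.nonNegative (ℚ.<⇒≤ (recipℚ-pos δ>0))}} (recipℚ-antitone δ>0 δ≤q) ⟩
        c ℚ.* c            ∎
        where
        open ℚ.≤-Reasoning
        a = recipℚ p
        b = recipℚ q
        c = recipℚ δ
        a>0 = recipℚ-pos (ℚ.<-≤-trans δ>0 δ≤p)
        b>0 = recipℚ-pos (ℚ.<-≤-trans δ>0 δ≤q)

  inverse : ∀ x → ¬ x ≈ 0ℝ → ∃[ y ] x * y ≈ 1ℝ
  inverse x x≉0 with em {x ≤ 0ℝ}
  ... | no  x≰0 = positive-inverse x x≰0
  ... | yes x≤0 = case positive-inverse (-ℝ x) (λ -x≤0 → x≉0 (≤-antisym x≤0 (nonneg -x≤0))) of λ where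
      (y , -xy≈1) → -ℝ y , ≈-trans
        (pointwise-≡ λ n → solve 2 (λ a b → a :* (:- b) := (:- a) :* b) ≡.refl (seq x n) (seq y n)) -xy≈1
    where
    nonneg : -ℝ x ≤ 0ℝ → 0ℝ ≤ x
    nonneg (mk≤ -x≤0) = mk≤ λ ε ε>0 → eventually-map
      (λ n -x<ε → ≡.subst₂ ℚ._<_ (ℚ.+-inverseʳ (seq x n)) (≡.cong (seq x n ℚ.+_) (ℚ.+-identityˡ ε))
        (ℚ.+-monoʳ-< (seq x n) -x<ε))
      (-x≤0 ε ε>0)

  1≰0 : ¬ 1ℝ ≤ 0ℝ
  1≰0 (mk≤ 1≤0) = case 1≤0 1ℚ (ℚ.positive⁻¹ 1ℚ) of λ where
    (N , 1<) → ℚ.<-irrefl (≡.sym (ℚ.+-identityˡ 1ℚ)) (1< N ℕ.≤-refl)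

  ℝ-orderedField : OrderedField
  ℝ-orderedField = record
    { commutativeRing = ℝ-commutativeRing
    ; _≤_             = _≤_
    ; isTotalOrder    = record
      { isPartialOrder = record
        { isPreorder = record
          { isEquivalence = Setoid.isEquivalence ℝ-setoid
          ; reflexive     = ≤-reflexive
          ; trans         = ≤-trans
          }
        ; antisym    = ≤-antisym
        }
      ; total          = ≤-total
      }
    ; +-monoʳ-≤       = +-monoʳ-≤
    ; *-nonNeg        = *-nonNeg
    ; inverse         = inverse
    ; 1≰0             = 1≰0
    }

-- Walks up to equality of vertices

module WalkProperties {d n} {A : Fin n → List (Point d)} {x : Point d} where
  open Graph (RG-CC A x)
  open Exchange
  module V = Setoid vertices

  conv-mono : ∀ {S T : Pred (Point d) 0ℓ} {y} → (∀ {p} → S p → T p) → conv S y → conv T y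
  conv-mono S⊆T c = record
    { size        = size
    ; point       = point
    ; weight      = weight
    ; point∈S     = λ i → S⊆T (point∈S i)
    ; weight≥0    = weight≥0
    ; weight-sum  = weight-sum
    ; combination = combination
    }
    where open conv c

  -- The conditions of an exchange are invariant under `_≋_`, so an equal vertex can take over the
  -- first edge.
  Walk-respˡ : ∀ {u u′ v} → u ≈ᵛ u′ → Walk (RG-CC A x) u′ v → Walk (RG-CC A x) u v
  Walk-respˡ {u} {u′} {v} u≈u′ (end u′≈v) = end (V.trans {u} {u′} {v} u≈u′ u′≈v)
  Walk-respˡ {u} {u′} u≈u′ (step {v = w} e rest) = step exchange rest
    where
    exchange : Exchange A x u w
    exchange = record
      { index   = index e
      ; differs = λ u≋w → differs e (λ k → ≈-trans (≈-sym (u≈u′ (index e) k)) (u≋w k))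
      ; unique  = λ i u≉w → unique e i (λ u′≋w → u≉w (λ k → ≈-trans (u≈u′ i k) (u′≋w k)))
      ; x∈conv  = conv-mono (λ (i , i≢j , p≋) → i , i≢j , λ k → ≈-trans (p≋ k) (≈-sym (u≈u′ i k))) (x∈conv e)
      }

  Walk-respʳ : ∀ {u v v′} → Walk (RG-CC A x) u v → v ≈ᵛ v′ → Walk (RG-CC A x) u v′
  Walk-respʳ {u} {v} {v′} (end u≈v) v≈v′ = end (V.trans {u} {v} {v′} u≈v v≈v′)
  Walk-respʳ (step e rest) v≈v′ = step e (Walk-respʳ rest v≈v′)

-- From convex hulls to cones and back

module Homogenisation (em : ExcludedMiddle 0ℓ) {d : ℕ} where
  open RealField em using (ℝ-orderedField; ℝ-commutativeRing)
  open FieldOrder em ℝ-orderedField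
  open LinearAlgebra em ℝ-orderedField
  open ConeCombinations em ℝ-orderedField
  open CommutativeRing ℝ-commutativeRing
    using (semiring; *-identityʳ; *-identityˡ; zeroˡ; +-identityʳ; +-identityˡ; +-cong; +-congʳ; *-congʳ)
  open SemiringSum semiring using (sum-cong-≋; sum-remove)

  lift : Point d → Vect (suc d)
  lift p = 1ℝ ∷ p

  lift-cong : ∀ {p q} → p ≋ q → ∀ k → lift p k ≈ lift q k
  lift-cong p≋q zero    = ≈-refl
  lift-cong p≋q (suc k) = p≋q k

  e₀ : Vect (suc d)
  e₀ = 1ℝ ∷ λ _ → 0ℝ

  e₀-lift : ∀ p → 0ℝ < dot e₀ (lift p)
  e₀-lift p ≤0 = RealField.1≰0 em (≤-respˡ
    (≈-trans (+-cong (*-identityʳ 1ℝ) (sum-0 (λ k → zeroˡ (p k)))) (+-identityʳ 1ℝ)) ≤0)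

  -- Weights that sum to 1 make the combination of the lifted points the lift of `x`: this is its
  -- coordinate zero. A homogeneous inequality then passes to nonnegative combinations.
  conv-polar : ∀ {S : Pred (Point d) 0ℓ} {x} r → conv S x →
               (∀ {p} → S p → dot r (lift p) ≤ 0ℝ) → dot r (lift x) ≤ 0ℝ
  conv-polar {x = x} r c polar = ≤-respˡ (≈-sym (dot-congˡ r lift-x≈))
    (dot-comb-nonPos r weight (λ i → lift (point i)) weight≥0 (λ i → polar (point∈S i)))
    where
    open conv c
    lift-x≈ : ∀ k → lift x k ≈ comb weight (λ i → lift (point i)) k
    lift-x≈ zero    = ≈-sym (≈-trans (sum-cong-≋ (λ i → *-identityʳ (weight i))) weight-sum)
    lift-x≈ (suc k) = combination k

  -- Coordinate zero of the cone identity says that the weights sum to 1, and the term of weight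
  -- zero can be left out.
  conv-without : ∀ {n} (a : Fin n → Point d) {x w} j →
                 Combination (λ i → lift (a i)) (lift x) w → w j ≈ 0ℝ → conv (rangeWithout j a) x
  conv-without {suc n} a {x} {w} j (w≥0 , wa≈x) wj≈0 = record
    { size        = n
    ; point       = λ i → a (punchIn j i)
    ; weight      = λ i → w (punchIn j i)
    ; point∈S     = λ i → punchIn j i , punchInᵢ≢i j i , λ _ → ≈-refl
    ; weight≥0    = λ i → w≥0 (punchIn j i)
    ; weight-sum  = ≈-trans (sum-cong-≋ (λ i → ≈-sym (*-identityʳ (w (punchIn j i))))) (drop zero)
    ; combination = λ k → ≈-sym (drop (suc k))
    }
    where
    drop : ∀ k → sum (λ i → w (punchIn j i) * lift (a (punchIn j i)) k) ≈ lift x k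
    drop k = ≈-trans (≈-sym (≈-trans (sum-remove {i = j} (λ i → w i * lift (a i) k))
      (≈-trans (+-congʳ (≈-trans (*-congʳ wj≈0) (zeroˡ _))) (+-identityˡ _)))) (wa≈x k)

-- States and low paths as vertices and walks

module Reconfiguration (em : ExcludedMiddle 0ℓ) {d n : ℕ} (A : Fin n → List (Point d)) (x : Point d)
  (x∈convA : ∀ i → x ∈ conv ⟦ A i ⟧) (n≥d+2 : n ≥ d ℕ.+ 2) where
  open RealField em using (ℝ-orderedField)
  open FieldOrder em ℝ-orderedField
  open LinearAlgebra em ℝ-orderedField
  open Homogenisation em {d}
  open WalkProperties {d} {n} {A} {x}
  open Graph (RG-CC A x)

  allPoints : List (Point d)
  allPoints = concat (tabulate A)

  pick : Fin (length allPoints) → Point d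
  pick = lookup allPoints

  -- One index set serves all colours, so an index may have several of them.
  Colour : Fin n → Fin (length allPoints) → Set
  Colour i q = pick q ∈ ⟦ A i ⟧

  find : ∀ i {p} → p ∈ ⟦ A i ⟧ → ∃[ q ] (Colour i q × p ≋ pick q)
  find i {p} p∈A = Any.index p∈all , Membership.∈-resp-≈ (Point-setoid d) p≋q p∈A , p≋q
    where
    p∈all = concat⁺ (tabulate⁺ {f = A} i p∈A)
    p≋q : p ≋ pick (Any.index p∈all)
    p≋q = lookup-index p∈all

  -- Contraposition of `conv-polar`, with the points of `A i` replaced by their indices in the
  -- common list.
  colour-meets : ∀ i r → 0ℝ < dot r (lift x) → ∃[ q ] (Colour i q × 0ℝ < dot r (lift (pick q)))
  colour-meets i r rx>0 with em {∃[ q ] (Colour i q × 0ℝ < dot r (lift (pick q)))}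
  ... | yes found = found
  ... | no  none  = contradiction (conv-polar r (x∈convA i) polar) rx>0
    where
    polar : ∀ {p} → p ∈ ⟦ A i ⟧ → dot r (lift p) ≤ 0ℝ
    polar p∈A = case find i p∈A of λ where
      (q , Cq , p≋q) → ≤-respˡ (≈-sym (dot-congˡ r (lift-cong p≋q))) (≮⇒≥ (λ rq>0 → none (q , Cq , rq>0)))

  d+1<n : suc d ℕ.< n
  d+1<n = ≡.subst (ℕ._≤ n) (ℕ.+-comm d 2) n≥d+2

  open ColourfulCones em ℝ-orderedField
  open Configuration (λ q → lift (pick q)) Colour (lift x) e₀ d+1<n (λ q → e₀-lift (pick q)) colour-meets
  open State
  open ColourfulTuple

  tupleOf : State → Fin n → Point d
  tupleOf s i = pick (choice s i)

  vertex : (s : State) → x ∈ conv (range (tupleOf s)) → Vertex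
  vertex s x∈ = record { tuple = tupleOf s ; chosen = valid s ; x∈conv = x∈ }

  edge-conv : ∀ s j → edgeHeight (choice s) j ≤ 0ℝ → x ∈ conv (rangeWithout j (tupleOf s))
  edge-conv s j E≤0 = case edge-combination s j E≤0 of λ where
    (w , wa≈x , wj≈0) → conv-without (tupleOf s) j wa≈x wj≈0

  ≡⇒≋ : ∀ {q q′} → q ≡ q′ → pick q ≋ pick q′
  ≡⇒≋ ≡.refl _ = ≈-refl

  agree-conv : ∀ s u j → AgreeOff j s u → x ∈ conv (rangeWithout j (tupleOf s)) → x ∈ conv (range (tupleOf u))
  agree-conv s u j agree = conv-mono λ (i , i≢j , p≋) → i , λ k → ≈-trans (p≋ k) (≡⇒≋ (agree i i≢j) k)

  -- Different indices may denote the same point, and a step may be idle. Then there is no exchange,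
  -- which demands a differing entry; the tuples are equal up to `_≋_`, and the walk simply
  -- continues from the next vertex.
  advance : ∀ s u j → AgreeOff j s u → (s∈ : x ∈ conv (range (tupleOf s))) (u∈ : x ∈ conv (range (tupleOf u))) →
            x ∈ conv (rangeWithout j (tupleOf s)) → ∀ {v} →
            Walk (RG-CC A x) (vertex u u∈) v → Walk (RG-CC A x) (vertex s s∈) v
  advance s u j agree s∈ u∈ x∈ rest with em {tupleOf s j ≋ tupleOf u j}
  ... | yes s≋u = Walk-respˡ {vertex s s∈} {vertex u u∈} (λ i → same i (i ≟ᶠ j)) rest
    where
    same : ∀ i → Dec (i ≡ j) → tupleOf s i ≋ tupleOf u i
    same i (yes ≡.refl) = s≋u
    same i (no  i≢j)    = ≡⇒≋ (agree i i≢j)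
  ... | no  s≉u = step {u = vertex s s∈} {v = vertex u u∈} exchanged rest
    where
    unique : ∀ i → Dec (i ≡ j) → ¬ tupleOf s i ≋ tupleOf u i → i ≡ j
    unique i (yes i≡j) _   = i≡j
    unique i (no  i≢j) s≉u = contradiction (≡⇒≋ (agree i i≢j)) s≉u
    exchanged : Exchange A x (vertex s s∈) (vertex u u∈)
    exchanged = record { index = j ; differs = s≉u ; unique = λ i → unique i (i ≟ᶠ j) ; x∈conv = x∈ }

  walk : ∀ {s t} → Path (_≤ 0ℝ) s t → (s∈ : x ∈ conv (range (tupleOf s))) (t∈ : x ∈ conv (range (tupleOf t))) →
         Walk (RG-CC A x) (vertex s s∈) (vertex t t∈)
  walk [] _ _ = end (λ _ _ → ≈-refl)
  walk {s} (_◅_ {j = u} (j , agree , E≤0) path) s∈ t∈ =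
    advance s u j agree s∈ u∈ x∈ (walk path u∈ t∈)
    where
    x∈ : x ∈ conv (rangeWithout j (tupleOf s))
    x∈ = edge-conv s j E≤0
    u∈ : x ∈ conv (range (tupleOf u))
    u∈ = agree-conv s u j agree x∈

  stateOf : ∀ (a : Vertex) → ∃[ s ] (∀ i → tuple a i ≋ tupleOf s i)
  stateOf a = record { choice = λ i → proj₁ (find i (chosen a i)) ; valid = λ i → proj₁ (proj₂ (find i (chosen a i))) }
            , λ i → proj₂ (proj₂ (find i (chosen a i)))

  stateOf-height : ∀ (a : Vertex) s → (∀ i → tuple a i ≋ tupleOf s i) → height s ≤ 0ℝ
  stateOf-height a s a≋s = height-zero {s} λ r polar → conv-polar r (x∈conv a) λ (i , p≋ai) →
    ≤-respˡ (≈-sym (dot-congˡ r (lift-cong (λ k → ≈-trans (p≋ai k) (a≋s i k))))) (polar i)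

  walks : ∀ a b → Walk (RG-CC A x) a b
  walks a b = case stateOf a of λ where
    (s , a≋s) → case stateOf b of λ where
      (t , b≋t) →
        let s∈ = conv-mono (λ (i , p≋) → i , λ k → ≈-trans (p≋ k) (a≋s i k)) (x∈conv a)
            t∈ = conv-mono (λ (i , p≋) → i , λ k → ≈-trans (p≋ k) (b≋t i k)) (x∈conv b)
        in Walk-respˡ {a} {vertex s s∈} a≋s
             (Walk-respʳ {vertex s s∈} {vertex t t∈} {b}
               (walk (connected s t (stateOf-height a s a≋s) (stateOf-height b t b≋t)) s∈ t∈)
               (λ i k → ≈-sym (b≋t i k)))

  nonempty : Vertex
  nonempty = case inhabited s₀ of λ where
      (s , j , E≤0) → vertex s (conv-mono (λ (i , _ , p≋) → i , p≋) (edge-conv s j E≤0))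
    where
    s₀ : State
    s₀ = record
      -- Any functional positive at `lift x` extracts a point of every colour; `e₀` is one at hand.
      { choice = λ i → proj₁ (colour-meets i e₀ (e₀-lift x))
      ; valid  = λ i → proj₁ (proj₂ (colour-meets i e₀ (e₀-lift x)))
      }

theorem7p5 : ExcludedMiddle 0ℓ →
    (d n : ℕ) (A : Fin n → List (Point d)) (x : Point d) →
    (∀ i → x ∈ conv ⟦ A i ⟧) →
    n ≥ d ℕ.+ 2 →
    Connected (RG-CC A x)
theorem7p5 em d n A x x∈convA n≥d+2 = nonempty , walks
  where open Reconfiguration em A x x∈convA n≥d+2
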